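{- Fix $\epsilon\in(0,1)$ and set $\alpha=1+1/f+3\epsilon$, $\beta=1+\epsilon$. Run the following algorithm in the dynamic setting described in the context: initially $E=\emptyset$ and every node is at level $0$; after each edge insertion/deletion, while there exists a dirty node $v$, pick any dirty node $v$ and, if $W_v>f\alpha\beta c^*_v$, set $\ell(v)\leftarrow\ell(v)+1$, else if $W_v<c^*_v$ and $\ell(v)>0$, set $\ell(v)\leftarrow\ell(v)-1$. Initialize a counter $\mathrm{COUNT}=0$ and increase it by one every time the level (equivalently, the weight) of an already existing edge changes as a result of such a level change of a node. Then, just after the $t$-th update has been handled, $\mathrm{COUNT}=O(tL/\epsilon)$.
   Context: Setting: hypergraph $G=(V,E)$ with $|V|=n$ nodes and at most $m$ edges at any time; node capacities $c_v>0$ with $c_{\min}=\min_v c_v$, multiplicity $\mu\ge1$; $\mathcal{E}_v$ is the set of edges incident upon $v$, $\mathcal{V}_e=\{v:e\in\mathcal{E}_v\}$, and every edge satisfies $|\mathcal{V}_e|\le f$. Dynamic setting: $V$, $c_v$, $\mu$, $f$, $m$ fixed; initially $E=\emptyset$; each update inserts or deletes one edge. Let $L=\lceil\log_\beta(m\mu\alpha/c_{\min})\rceil$. Each node has a level $\ell(v)\in\{0,\dots,L\}$; an edge has level $\ell(e)=\max_{v\in\mathcal{V}_e}\ell(v)$ and weight $w(e)=\mu\beta^{ -\ell(e)}$; $W_v=\sum_{e\in\mathcal{E}_v}w(e)$; $c^*_v=c_v/(f\alpha\beta)$. A node $v$ is dirty if it violates the invariant "if $\ell(v)>0$ then $c^*_v\le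 W_v\le f\alpha\beta c^*_v$, and if $\ell(v)=0$ then $W_v\le f\alpha\beta c^*_v$", and clean otherwise.
   Formalization: The formal theorem takes ε, the multiplicity μ and the node capacities c_v (hence c_min) to be rational numbers instead of real numbers. -}

module Defs where

open import Data.Nat as ℕ using (ℕ; zero; suc; _⊔_)
open import Data.Bool using (Bool; true; false; if_then_else_)
open import Data.Fin using (Fin)
open import Data.Fin.Subset using (Subset; ∣_∣)
open import Data.Vec using (lookup)
open import Data.List using (List; []; _∷_; foldr; length; allFin)
open import Data.List.Membership.Propositional using (_∈_; _∉_)
open import Data.Integer using (+_)
open import Data.Rational using (ℚ; 0ℚ; 1ℚ; _+_; _*_; _≤_; _<_; ≢-nonZero; 1/_)
import Data.Rational as ℚ
open import Data.Rational.Properties using (_≟_)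
open import Data.Product using (Σ; _×_; _,_; ∃)
open import Data.Sum using (_⊎_)
open import Relation.Nullary using (¬_; yes; no)
open import Relation.Binary.PropositionalEquality using (_≡_; _≢_)
open import Relation.Binary.Construct.Closure.ReflexiveTransitive using (Star)
import Data.Vec.Properties as VecP
import Data.Bool.Properties as BoolP

ℕ→ℚ : ℕ → ℚ
ℕ→ℚ k = + k ℚ./ 1

-- total multiplicative inverse (0⁻¹ := 0); only ever applied to positive numbers here
inv : ℚ → ℚ
inv p with p ≟ 0ℚ
... | yes _ = 0ℚ
... | no p≢0 = 1/_ p {{≢-nonZero p≢0}}

pow : ℚ → ℕ → ℚ
pow p zero = 1ℚ
pow p (suc k) = p * pow p k

-- L = ⌈log_β x⌉ (read as max(0, ·)): least natural L with x ≤ β^L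
IsCeilLog : (β x : ℚ) → ℕ → Set
IsCeilLog β x L = (x ≤ pow β L) × (∀ k → x ≤ pow β k → L ℕ.≤ k)

module Dyn (n f m : ℕ) (μ ε : ℚ) (c : Fin n → ℚ) where

  α β : ℚ
  α = 1ℚ + inv (ℕ→ℚ f) + ℕ→ℚ 3 * ε
  β = 1ℚ + ε

  fαβ : ℚ
  fαβ = ℕ→ℚ f * α * β

  c* : Fin n → ℚ
  c* v = c v * inv fαβ

  -- a (hyper)edge is its set of endpoints 𝒱_e
  Edge : Set
  Edge = Subset n

  Levels : Set
  Levels = Fin n → ℕ

  edgeLevel : Levels → Edge → ℕ
  edgeLevel lv e = foldr (λ v acc → (if lookup e v then lv v else 0) ⊔ acc) 0 (allFin n)

  weight : Levels → Edge → ℚ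
  weight lv e = μ * pow (inv β) (edgeLevel lv e)

  W : List Edge → Levels → Fin n → ℚ
  W E lv v = foldr (λ e acc → if lookup e v then weight lv e + acc else acc) 0ℚ E

  Dirty : List Edge → Levels → Fin n → Set
  Dirty E lv v with lv v
  ... | zero  = ¬ (W E lv v ≤ fαβ * c* v)
  ... | suc _ = ¬ ((c* v ≤ W E lv v) × (W E lv v ≤ fαβ * c* v))

  Clean : List Edge → Levels → Fin n → Set
  Clean E lv v = ¬ Dirty E lv v

  changed : Levels → Levels → List Edge → ℕ
  changed lv lv' [] = 0
  changed lv lv' (e ∷ E) with edgeLevel lv e ℕ.≟ edgeLevel lv' e
  ... | yes _ = changed lv lv' E
  ... | no _  = suc (changed lv lv' E)

  setLevel : Levels → Fin n → ℕ → Levels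
  setLevel lv v k u with Data.Fin._≟_ u v
  ... | yes _ = k
  ... | no _  = lv u

  record Config : Set where
    constructor cfg
    field
      edges : List Edge
      levels : Levels
      count : ℕ
  open Config public

  initial : Config
  initial = cfg [] (λ _ → 0) 0

  data FixStep : Config → Config → Set where
    up   : ∀ E lv k v → Dirty E lv v → fαβ * c* v < W E lv v →
           FixStep (cfg E lv k) (cfg E (setLevel lv v (suc (lv v)))
                     (k ℕ.+ changed lv (setLevel lv v (suc (lv v))) E))
    down : ∀ E lv k v l → Dirty E lv v → ¬ (fαβ * c* v < W E lv v) →
           W E lv v < c* v → lv v ≡ suc l →
           FixStep (cfg E lv k) (cfg E (setLevel lv v l)
                     (k ℕ.+ changed lv (setLevel lv v l) E))

  remove : Edge → List Edge → List Edge
  remove e [] = []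
  remove e (e' ∷ E) with VecP.≡-dec BoolP._≟_ e e'
  ... | yes _ = E
  ... | no _  = e' ∷ remove e E

  data Update : Config → Config → Set where
    insert : ∀ E lv k (e : Edge) → e ∉ E → 1 ℕ.≤ ∣ e ∣ → ∣ e ∣ ℕ.≤ f →
             length (e ∷ E) ℕ.≤ m →
             Update (cfg E lv k) (cfg (e ∷ E) lv k)
    delete : ∀ E lv k (e : Edge) → e ∈ E →
             Update (cfg E lv k) (cfg (remove e E) lv k)

  AllClean : Config → Set
  AllClean s = ∀ v → Clean (edges s) (levels s) v

  -- Handled t s : s is a configuration just after the t-th update has been
  -- handled (the while loop has terminated), for some sequence of updates and
  -- some choices of dirty nodes
  data Handled : ℕ → Config → Set where
    start : Handled 0 initial
    next  : ∀ {t s s₁ s₂} → Handled t s → Update s s₁ → Star FixStep s₁ s₂ →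
            AllClean s₂ → Handled (suc t) s₂

{-# OPTIONS --safe #-}

-- A potential argument. Besides (1 + ε)(L − ℓ(e)) for every edge, each node u carries
--   (β + β² + … + β^ℓ(u)) / (fμ) · max(0, fα c*_u − W_u);
-- everything below is multiplied by fμ to avoid the division. With β^{ℓ(u)+1}/ε in place
-- of the geometric sum, a deletion would cost 1/ε, which L need not dominate; with
-- the sum it costs at most L, since (β + … + β^l) β^{-l} ≤ l.
-- * Raising v from level l: W_v drops by at most a factor β, so the term of v becomes 0.
--   A moved edge loses weight μ ε β^{-l-1}, which costs each of its at most f endpoints
--   at most 1/f, since ε (β + … + β^l) ≤ β^{l+1}; the edge term pays 1 + ε.
-- * Lowering v from level l: the moved edges, x of them, have x μ β^{-l} ≤ W_v < c*_v,
--   so v releases at least β^l (fα − 1) c*_v / (fμ) ≥ (1 + 3ε) x, and edge terms absorb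
--   (1 + ε) x.
-- Either way the potential falls by ε per moved edge, and an update raises it by at most 2L.
-- Levels never exceed L because W_v ≤ m μ β^{-L} ≤ c_v at level L.

module Submission where

open import Defs
open import Data.Bool using (true; false; if_then_else_)
open import Data.Nat using (ℕ; zero; suc; z≤n; s≤s)
import Data.Nat
import Data.Nat as ℕ
import Data.Nat.Properties as ℕₚ
import Data.Integer as ℤ
import Data.Integer.Properties as ℤₚ
open import Data.Fin using (Fin; zero; suc)
import Data.Fin as Fin
open import Data.Fin.Subset using (Subset; ∣_∣)
open import Data.Vec using ([]; _∷_; lookup)
import Data.Vec.Properties as VecP
import Data.Bool.Properties as BoolP
open import Data.List using (List; []; _∷_; foldr; length; allFin)
open import Data.List.Membership.Propositional using (_∈_)
open import Data.List.Membership.Propositional.Properties using (∈-allFin)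
open import Data.List.Relation.Unary.Any using (here; there)
open import Data.List.Relation.Unary.All as All using (All; []; _∷_)
open import Data.Rational using (ℚ; 0ℚ; 1ℚ; _≤_; _<_; _+_; _*_; _-_; -_; _⊔_; toℚᵘ; nonNegative; positive; ≢-nonZero)
import Data.Rational as ℚ
open import Data.Rational.Properties
import Data.Rational.Unnormalised as ℚᵘ
import Data.Rational.Unnormalised.Properties as ℚᵘₚ
open import Data.Product using (Σ; ∃; _×_; _,_; proj₁; proj₂)
open import Data.Sum using (_⊎_; inj₁; inj₂; [_,_]′)
open import Function using (_∘_)
open import Level using (0ℓ)
open import Relation.Nullary using (Dec; yes; no; contradiction)
open import Relation.Nullary.Decidable using (dec⇒maybe)
open import Relation.Binary.Construct.Closure.ReflexiveTransitive using (Star; ε; _◅_)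
open import Relation.Binary.PropositionalEquality using (_≡_; _≢_; refl; sym; trans; cong; cong₂; subst; subst₂)
open import Tactic.RingSolver using (solve-∀)
open import Tactic.RingSolver.Core.AlmostCommutativeRing using (AlmostCommutativeRing; fromCommutativeRing)
open import Algebra.Properties.CommutativeMonoid.Sum +-0-commutativeMonoid using (sum; sum-cong-≗; sum-replicate-zero; ∑-distrib-+)
open ≤-Reasoning

ring : AlmostCommutativeRing 0ℓ 0ℓ
ring = fromCommutativeRing +-*-commutativeRing λ x → dec⇒maybe (0ℚ ≟ x)

-- Rational arithmetic

*-mono-≤ˡ : ∀ {r p q} → 0ℚ ≤ r → p ≤ q → r * p ≤ r * q
*-mono-≤ˡ {r} 0≤r = *-monoˡ-≤-nonNeg r {{nonNegative 0≤r}}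

*-mono-≤ʳ : ∀ {r p q} → 0ℚ ≤ r → p ≤ q → p * r ≤ q * r
*-mono-≤ʳ {r} 0≤r = *-monoʳ-≤-nonNeg r {{nonNegative 0≤r}}

+-nonNeg : ∀ {p q} → 0ℚ ≤ p → 0ℚ ≤ q → 0ℚ ≤ p + q
+-nonNeg = +-mono-≤

*-nonNeg : ∀ {p q} → 0ℚ ≤ p → 0ℚ ≤ q → 0ℚ ≤ p * q
*-nonNeg {p} {q} 0≤p 0≤q = subst (_≤ p * q) (*-zeroʳ p) (*-mono-≤ˡ 0≤p 0≤q)

*-pos : ∀ {p q} → 0ℚ < p → 0ℚ < q → 0ℚ < p * q
*-pos {p} {q} 0<p 0<q = subst (_< p * q) (*-zeroʳ p) (*-monoʳ-<-pos p {{positive 0<p}} 0<q)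

p≤p+q : ∀ {p q} → 0ℚ ≤ q → p ≤ p + q
p≤p+q {p} {q} 0≤q = subst (_≤ p + q) (+-identityʳ p) (+-monoʳ-≤ p 0≤q)

q≤p+q : ∀ {p q} → 0ℚ ≤ p → q ≤ p + q
q≤p+q {p} {q} 0≤p = subst (_≤ p + q) (+-identityˡ q) (+-monoˡ-≤ q 0≤p)

p≤q⇒0≤q-p : ∀ {p q} → p ≤ q → 0ℚ ≤ q - p
p≤q⇒0≤q-p {p} {q} p≤q = subst (_≤ q - p) (+-inverseʳ p) (+-monoˡ-≤ (- p) p≤q)

p≤q⇒p-q≤0 : ∀ {p q} → p ≤ q → p - q ≤ 0ℚ
p≤q⇒p-q≤0 {p} {q} p≤q = subst (p - q ≤_) (+-inverseʳ q) (+-monoˡ-≤ (- q) p≤q)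

0≤1 : 0ℚ ≤ 1ℚ
0≤1 = nonNegative⁻¹ 1ℚ

inv-inverseʳ : ∀ {p} → 0ℚ < p → p * inv p ≡ 1ℚ
inv-inverseʳ {p} 0<p with p ≟ 0ℚ
... | yes refl = contradiction 0<p (<-irrefl refl)
... | no p≢0 = *-inverseʳ p {{≢-nonZero p≢0}}

inv-nonNeg : ∀ {p} → 0ℚ < p → 0ℚ ≤ inv p
inv-nonNeg {p} 0<p with p ≟ 0ℚ
... | yes _ = ≤-refl
... | no p≢0 = nonNegative⁻¹ (1/p) {{pos⇒nonNeg (1/p) {{1/pos⇒pos p {{positive 0<p}}}}}}
  where
  1/p = ℚ.1/_ p {{≢-nonZero p≢0}}

toℚᵘ-ℕ→ℚ : ∀ k → toℚᵘ (ℕ→ℚ k) ℚᵘ.≃ ℚᵘ.mkℚᵘ (ℤ.+ k) 0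
toℚᵘ-ℕ→ℚ k = toℚᵘ-fromℚᵘ (ℚᵘ.mkℚᵘ (ℤ.+ k) 0)

-- `ℕ→ℚ` divides by 1 and so normalises by a gcd, which is stuck on variables. The identity is
-- therefore checked on unnormalised rationals, where equality is cross-multiplication.
ℕ→ℚ-+ : ∀ a b → ℕ→ℚ (a ℕ.+ b) ≡ ℕ→ℚ a + ℕ→ℚ b
ℕ→ℚ-+ a b = toℚᵘ-injective (begin-≃
  toℚᵘ (ℕ→ℚ (a ℕ.+ b))                          ≈⟨ toℚᵘ-ℕ→ℚ (a ℕ.+ b) ⟩
  ℚᵘ.mkℚᵘ (ℤ.+ (a ℕ.+ b)) 0                     ≈⟨ ℚᵘ.*≡* (cong (ℤ._* ℤ.+ 1) numerators) ⟩
  ℚᵘ.mkℚᵘ (ℤ.+ a) 0 ℚᵘ.+ ℚᵘ.mkℚᵘ (ℤ.+ b) 0      ≈⟨ ℚᵘₚ.+-cong (toℚᵘ-ℕ→ℚ a) (toℚᵘ-ℕ→ℚ b) ⟨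
  toℚᵘ (ℕ→ℚ a) ℚᵘ.+ toℚᵘ (ℕ→ℚ b)                ≈⟨ toℚᵘ-homo-+ (ℕ→ℚ a) (ℕ→ℚ b) ⟨
  toℚᵘ (ℕ→ℚ a + ℕ→ℚ b)                          ∎≃)
  where
  open import Relation.Binary.Reasoning.Setoid ℚᵘₚ.≃-setoid using (step-≈-⟩; step-≈-⟨) renaming (begin_ to begin-≃_; _∎ to _∎≃)
  numerators : ℤ.+ (a ℕ.+ b) ≡ ℤ.+ a ℤ.* ℤ.+ 1 ℤ.+ ℤ.+ b ℤ.* ℤ.+ 1
  numerators = sym (cong₂ ℤ._+_ (ℤₚ.*-identityʳ (ℤ.+ a)) (ℤₚ.*-identityʳ (ℤ.+ b)))

ℕ→ℚ-* : ∀ a b → ℕ→ℚ (a ℕ.* b) ≡ ℕ→ℚ a * ℕ→ℚ b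
ℕ→ℚ-* zero b = sym (*-zeroˡ (ℕ→ℚ b))
ℕ→ℚ-* (suc a) b = begin-equality
  ℕ→ℚ (b ℕ.+ a ℕ.* b)      ≡⟨ ℕ→ℚ-+ b (a ℕ.* b) ⟩
  ℕ→ℚ b + ℕ→ℚ (a ℕ.* b)    ≡⟨ cong (ℕ→ℚ b +_) (ℕ→ℚ-* a b) ⟩
  ℕ→ℚ b + ℕ→ℚ a * ℕ→ℚ b    ≡⟨ factor (ℕ→ℚ a) (ℕ→ℚ b) ⟩
  (1ℚ + ℕ→ℚ a) * ℕ→ℚ b     ≡⟨ cong (_* ℕ→ℚ b) (ℕ→ℚ-+ 1 a) ⟨
  ℕ→ℚ (suc a) * ℕ→ℚ b      ∎
  where
  factor : ∀ x y → y + x * y ≡ (1ℚ + x) * y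
  factor = solve-∀ ring

0≤ℕ→ℚ : ∀ k → 0ℚ ≤ ℕ→ℚ k
0≤ℕ→ℚ k = nonNegative⁻¹ (ℕ→ℚ k) {{normalize-nonNeg k 1}}

ℕ→ℚ-mono-≤ : ∀ {a b} → a ℕ.≤ b → ℕ→ℚ a ≤ ℕ→ℚ b
ℕ→ℚ-mono-≤ {a} {b} a≤b = begin
  ℕ→ℚ a                      ≤⟨ p≤p+q (0≤ℕ→ℚ (b ℕ.∸ a)) ⟩
  ℕ→ℚ a + ℕ→ℚ (b ℕ.∸ a)      ≡⟨ ℕ→ℚ-+ a (b ℕ.∸ a) ⟨
  ℕ→ℚ (a ℕ.+ (b ℕ.∸ a))      ≡⟨ cong ℕ→ℚ (ℕₚ.m+[n∸m]≡n a≤b) ⟩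
  ℕ→ℚ b                      ∎

-- Truncated deficits

deficit : ℚ → ℚ → ℚ
deficit A x = 0ℚ ⊔ (A - x)

0≤deficit : ∀ A x → 0ℚ ≤ deficit A x
0≤deficit A x = p≤p⊔q 0ℚ (A - x)

A-x≤deficit : ∀ A x → A - x ≤ deficit A x
A-x≤deficit A x = p≤q⊔p 0ℚ (A - x)

deficit-zero : ∀ {A x} → A ≤ x → deficit A x ≡ 0ℚ
deficit-zero A≤x = p≥q⇒p⊔q≡p (p≤q⇒p-q≤0 A≤x)

deficit-antimono : ∀ A {x y} → x ≤ y → deficit A y ≤ deficit A x
deficit-antimono A x≤y = ⊔-monoʳ-≤ 0ℚ (+-monoʳ-≤ A (neg-antimono-≤ x≤y))

-- Truncation at 0 is 1-Lipschitz. The drop from `x` to `y` is bounded only after scaling by `g`,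
-- because the callers control `geo` times a change of weight. The sign of `δ` serves the case where
-- the deficit at `y` has vanished.
deficit-lipschitz : ∀ A {g x y δ} → 0ℚ ≤ g → 0ℚ ≤ δ → g * x ≤ g * y + δ →
                    g * deficit A y ≤ g * deficit A x + δ
deficit-lipschitz A {g} {x} {y} {δ} 0≤g 0≤δ gx≤gy+δ with ≤-total A y
... | inj₁ A≤y = begin
  g * deficit A y        ≡⟨ cong (g *_) (deficit-zero A≤y) ⟩
  g * 0ℚ                 ≡⟨ *-zeroʳ g ⟩
  0ℚ                     ≤⟨ +-nonNeg (*-nonNeg 0≤g (0≤deficit A x)) 0≤δ ⟩
  g * deficit A x + δ    ∎
... | inj₂ y≤A = begin
  g * deficit A y                     ≡⟨ cong (g *_) (p≤q⇒p⊔q≡q (p≤q⇒0≤q-p y≤A)) ⟩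
  g * (A - y)                         ≡⟨ split g A x y ⟩
  g * (A - x) + (g * x - g * y)       ≤⟨ +-mono-≤ (*-mono-≤ˡ 0≤g (A-x≤deficit A x)) gap ⟩
  g * deficit A x + δ                 ∎
  where
  split : ∀ g A x y → g * (A - y) ≡ g * (A - x) + (g * x - g * y)
  split = solve-∀ ring
  cancel : ∀ p q → p + q - p ≡ q
  cancel = solve-∀ ring
  gap : g * x - g * y ≤ δ
  gap = subst (g * x - g * y ≤_) (cancel (g * y) δ) (+-monoˡ-≤ (- (g * y)) gx≤gy+δ)

-- Sums over nodes

sum-mono-≤ : ∀ {n} {g h : Fin n → ℚ} → (∀ u → g u ≤ h u) → sum g ≤ sum h
sum-mono-≤ {zero} g≤h = ≤-refl
sum-mono-≤ {suc n} g≤h = +-mono-≤ (g≤h zero) (sum-mono-≤ (g≤h ∘ suc))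

-- Made for lowering a node: the term of the lowered node pays `δ`, and the other terms need only
-- not grow.
sum-mono-gain : ∀ {n} {g h : Fin n → ℚ} {δ} v → (∀ u → u ≢ v → g u ≤ h u) → g v + δ ≤ h v →
                sum g + δ ≤ sum h
sum-mono-gain {suc n} {g} {h} {δ} zero others gain = begin
  g zero + sum (g ∘ suc) + δ      ≡⟨ swap (g zero) (sum (g ∘ suc)) δ ⟩
  g zero + δ + sum (g ∘ suc)      ≤⟨ +-mono-≤ gain (sum-mono-≤ λ u → others (suc u) λ ()) ⟩
  h zero + sum (h ∘ suc)          ∎
  where
  swap : ∀ a b c → a + b + c ≡ a + c + b
  swap = solve-∀ ring
sum-mono-gain {suc n} {g} {h} {δ} (suc v) others gain = begin
  g zero + sum (g ∘ suc) + δ      ≡⟨ +-assoc (g zero) (sum (g ∘ suc)) δ ⟩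
  g zero + (sum (g ∘ suc) + δ)    ≤⟨ +-mono-≤ (others zero λ ()) (sum-mono-gain v (λ u u≢v → others (suc u) λ { refl → u≢v refl }) gain) ⟩
  h zero + sum (h ∘ suc)          ∎

-- Powers of β = 1 + ε and of b = β⁻¹

module Powers {ε b : ℚ} (0≤ε : 0ℚ ≤ ε) (0≤b : 0ℚ ≤ b) (βb≡1 : (1ℚ + ε) * b ≡ 1ℚ) where

  pow-nonNeg : ∀ {p} → 0ℚ ≤ p → ∀ l → 0ℚ ≤ pow p l
  pow-nonNeg 0≤p zero = 0≤1
  pow-nonNeg 0≤p (suc l) = *-nonNeg 0≤p (pow-nonNeg 0≤p l)

  0≤β : 0ℚ ≤ 1ℚ + ε
  0≤β = +-nonNeg 0≤1 0≤ε

  β*powb : ∀ l → (1ℚ + ε) * pow b (suc l) ≡ pow b l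
  β*powb l = begin-equality
    (1ℚ + ε) * (b * pow b l)     ≡⟨ *-assoc (1ℚ + ε) b (pow b l) ⟨
    (1ℚ + ε) * b * pow b l       ≡⟨ cong (_* pow b l) βb≡1 ⟩
    1ℚ * pow b l                 ≡⟨ *-identityˡ (pow b l) ⟩
    pow b l                      ∎

  powβ*powb : ∀ l → pow (1ℚ + ε) l * pow b l ≡ 1ℚ
  powβ*powb zero = refl
  powβ*powb (suc l) = begin-equality
    (1ℚ + ε) * pow (1ℚ + ε) l * pow b (suc l)      ≡⟨ rearrange (1ℚ + ε) (pow (1ℚ + ε) l) (pow b (suc l)) ⟩
    pow (1ℚ + ε) l * ((1ℚ + ε) * pow b (suc l))    ≡⟨ cong (pow (1ℚ + ε) l *_) (β*powb l) ⟩
    pow (1ℚ + ε) l * pow b l                       ≡⟨ powβ*powb l ⟩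
    1ℚ                                             ∎
    where
    rearrange : ∀ x y z → x * y * z ≡ y * (x * z)
    rearrange = solve-∀ ring

  b≤1 : b ≤ 1ℚ
  b≤1 = begin
    b                ≤⟨ p≤p+q (*-nonNeg 0≤ε 0≤b) ⟩
    b + ε * b        ≡⟨ expand ε b ⟨
    (1ℚ + ε) * b     ≡⟨ βb≡1 ⟩
    1ℚ               ∎
    where
    expand : ∀ ε b → (1ℚ + ε) * b ≡ b + ε * b
    expand = solve-∀ ring

  powb-suc≤ : ∀ l → pow b (suc l) ≤ pow b l
  powb-suc≤ l = subst (pow b (suc l) ≤_) (*-identityˡ (pow b l)) (*-mono-≤ʳ (pow-nonNeg 0≤b l) b≤1)

  powb-antimono : ∀ {i j} → i ℕ.≤ j → pow b j ≤ pow b i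
  powb-antimono {i} i≤j = go (ℕₚ.≤⇒≤′ i≤j)
    where
    go : ∀ {j} → i ℕ.≤′ j → pow b j ≤ pow b i
    go (ℕ.≤′-reflexive refl) = ≤-refl
    go (ℕ.≤′-step {j} i≤′j) = ≤-trans (powb-suc≤ j) (go i≤′j)

  -- Starting the sum at β rather than at 1 makes the factor 0 at level 0: a node there carries no
  -- potential however light it is, so the initial potential vanishes.
  geo : ℕ → ℚ
  geo zero = 0ℚ
  geo (suc l) = pow (1ℚ + ε) (suc l) + geo l

  geo-nonNeg : ∀ l → 0ℚ ≤ geo l
  geo-nonNeg zero = ≤-refl
  geo-nonNeg (suc l) = +-nonNeg (pow-nonNeg 0≤β (suc l)) (geo-nonNeg l)

  -- Each of the `l` powers summed in `geo l` is at most the `l`-th. This makes the cost of a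
  -- deletion at an endpoint proportional to its level.
  geo*powb≤l : ∀ l → geo l * pow b l ≤ ℕ→ℚ l
  geo*powb≤l zero = ≤-refl
  geo*powb≤l (suc l) = begin
    (pow (1ℚ + ε) (suc l) + geo l) * pow b (suc l)
      ≡⟨ *-distribʳ-+ (pow b (suc l)) (pow (1ℚ + ε) (suc l)) (geo l) ⟩
    pow (1ℚ + ε) (suc l) * pow b (suc l) + geo l * pow b (suc l)
      ≤⟨ +-mono-≤ (≤-reflexive (powβ*powb (suc l))) (*-mono-≤ˡ (geo-nonNeg l) (powb-suc≤ l)) ⟩
    1ℚ + geo l * pow b l
      ≤⟨ +-monoʳ-≤ 1ℚ (geo*powb≤l l) ⟩
    1ℚ + ℕ→ℚ l
      ≡⟨ ℕ→ℚ-+ 1 l ⟨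
    ℕ→ℚ (suc l) ∎

  -- The closed form of the geometric sum, (β - 1)(β + ... + β^l) = β^(l+1) - β, arranged without
  -- subtraction.
  ε*geo+β≡powβ : ∀ l → ε * geo l + (1ℚ + ε) ≡ pow (1ℚ + ε) (suc l)
  ε*geo+β≡powβ zero = base ε
    where
    base : ∀ ε → ε * 0ℚ + (1ℚ + ε) ≡ (1ℚ + ε) * 1ℚ
    base = solve-∀ ring
  ε*geo+β≡powβ (suc l) = begin-equality
    ε * (P + geo l) + (1ℚ + ε)        ≡⟨ regroup ε P (geo l) ⟩
    ε * P + (ε * geo l + (1ℚ + ε))    ≡⟨ cong (ε * P +_) (ε*geo+β≡powβ l) ⟩
    ε * P + P                         ≡⟨ collect ε P ⟩
    (1ℚ + ε) * P                      ∎
    where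
    P = pow (1ℚ + ε) (suc l)
    regroup : ∀ ε P g → ε * (P + g) + (1ℚ + ε) ≡ ε * P + (ε * g + (1ℚ + ε))
    regroup = solve-∀ ring
    collect : ∀ ε P → ε * P + P ≡ (1ℚ + ε) * P
    collect = solve-∀ ring

  ε*geo*powb≤1 : ∀ l → ε * geo l * pow b (suc l) ≤ 1ℚ
  ε*geo*powb≤1 l = begin
    ε * geo l * pow b (suc l)               ≤⟨ *-mono-≤ʳ (pow-nonNeg 0≤b (suc l)) (p≤p+q {ε * geo l} 0≤β) ⟩
    (ε * geo l + (1ℚ + ε)) * pow b (suc l)  ≡⟨ cong (_* pow b (suc l)) (ε*geo+β≡powβ l) ⟩
    pow (1ℚ + ε) (suc l) * pow b (suc l)    ≡⟨ powβ*powb (suc l) ⟩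
    1ℚ                                      ∎

-- Sums over edges

-- The contribution of one edge as a vector over the nodes. It turns the conditional in the fold for
-- `W` into an additive summand, so that sums over nodes split edge by edge.
gated : ∀ {n} → Subset n → ℚ → Fin n → ℚ
gated e x u = if lookup e u then x else 0ℚ

sum-gated : ∀ {n} (e : Subset n) x → sum (gated e x) ≡ ℕ→ℚ ∣ e ∣ * x
sum-gated [] x = sym (*-zeroˡ x)
sum-gated (true ∷ e) x = begin-equality
  x + sum (gated e x)          ≡⟨ cong (x +_) (sum-gated e x) ⟩
  x + ℕ→ℚ ∣ e ∣ * x            ≡⟨ factor (ℕ→ℚ ∣ e ∣) x ⟩
  (1ℚ + ℕ→ℚ ∣ e ∣) * x         ≡⟨ cong (_* x) (ℕ→ℚ-+ 1 ∣ e ∣) ⟨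
  ℕ→ℚ (suc ∣ e ∣) * x          ∎
  where
  factor : ∀ k x → x + k * x ≡ (1ℚ + k) * x
  factor = solve-∀ ring
sum-gated (false ∷ e) x = trans (+-identityˡ (sum (gated e x))) (sum-gated e x)

sum-gated≤ : ∀ {n f} (e : Subset n) {x} → ∣ e ∣ ℕ.≤ f → 0ℚ ≤ x → sum (gated e x) ≤ ℕ→ℚ f * x
sum-gated≤ e {x} ∣e∣≤f 0≤x = ≤-trans (≤-reflexive (sum-gated e x)) (*-mono-≤ʳ 0≤x (ℕ→ℚ-mono-≤ ∣e∣≤f))

gated-nonNeg : ∀ {n} (e : Subset n) {x} → 0ℚ ≤ x → ∀ u → 0ℚ ≤ gated e x u
gated-nonNeg e 0≤x u with lookup e u
... | true = 0≤x
... | false = ≤-refl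

gated-scale≤ : ∀ {n} (e : Subset n) u g x {y} → (lookup e u ≡ true → g * x ≤ y) → g * gated e x u ≤ gated e y u
gated-scale≤ e u g x gx≤y with lookup e u
... | true = gx≤y refl
... | false = ≤-reflexive (*-zeroʳ g)

module _ {n : ℕ} where

  total : (Subset n → ℚ) → List (Subset n) → ℚ
  total h = foldr (λ e acc → h e + acc) 0ℚ

  -- The fold has the shape of `W`, so `W E lv v` is `sumAt (weight lv) E v` by definition and the
  -- lemmas below apply to node weights directly.
  sumAt : (Subset n → ℚ) → List (Subset n) → Fin n → ℚ
  sumAt h E v = foldr (λ e acc → if lookup e v then h e + acc else acc) 0ℚ E

  total-mono-≤ : ∀ {g h} → (∀ e → g e ≤ h e) → ∀ E → total g E ≤ total h E
  total-mono-≤ g≤h [] = ≤-refl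
  total-mono-≤ g≤h (e ∷ E) = +-mono-≤ (g≤h e) (total-mono-≤ g≤h E)

  total-+ : ∀ g h E → total (λ e → g e + h e) E ≡ total g E + total h E
  total-+ g h [] = refl
  total-+ g h (e ∷ E) = trans (cong (g e + h e +_) (total-+ g h E)) (swap (g e) (h e) (total g E) (total h E))
    where
    swap : ∀ a b c d → a + b + (c + d) ≡ a + c + (b + d)
    swap = solve-∀ ring

  total-nonNeg : ∀ {h} → (∀ e → 0ℚ ≤ h e) → ∀ E → 0ℚ ≤ total h E
  total-nonNeg 0≤h [] = ≤-refl
  total-nonNeg 0≤h (e ∷ E) = +-nonNeg (0≤h e) (total-nonNeg 0≤h E)

  sumAt-∷ : ∀ h e E u → sumAt h (e ∷ E) u ≡ gated e (h e) u + sumAt h E u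
  sumAt-∷ h e E u with lookup e u
  ... | true = refl
  ... | false = sym (+-identityˡ (sumAt h E u))

  sumAt≤sumAt-∷ : ∀ {h} → (∀ e → 0ℚ ≤ h e) → ∀ e E u → sumAt h E u ≤ sumAt h (e ∷ E) u
  sumAt≤sumAt-∷ {h} 0≤h e E u = begin
    sumAt h E u                        ≤⟨ q≤p+q (gated-nonNeg e (0≤h e) u) ⟩
    gated e (h e) u + sumAt h E u      ≡⟨ sumAt-∷ h e E u ⟨
    sumAt h (e ∷ E) u                  ∎

  sumAt-mono-≤ : ∀ {g h} v → (∀ e → lookup e v ≡ true → g e ≤ h e) → ∀ E → sumAt g E v ≤ sumAt h E v
  sumAt-mono-≤ v g≤h [] = ≤-refl
  sumAt-mono-≤ v g≤h (e ∷ E) with lookup e v in v∈e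
  ... | true = +-mono-≤ (g≤h e v∈e) (sumAt-mono-≤ v g≤h E)
  ... | false = sumAt-mono-≤ v g≤h E

  sumAt-+ : ∀ g h E v → sumAt (λ e → g e + h e) E v ≡ sumAt g E v + sumAt h E v
  sumAt-+ g h [] v = refl
  sumAt-+ g h (e ∷ E) v with lookup e v
  ... | false = sumAt-+ g h E v
  ... | true = trans (cong (g e + h e +_) (sumAt-+ g h E v)) (swap (g e) (h e) (sumAt g E v) (sumAt h E v))
    where
    swap : ∀ a b c d → a + b + (c + d) ≡ a + c + (b + d)
    swap = solve-∀ ring

  sumAt-* : ∀ x h E v → sumAt (λ e → x * h e) E v ≡ x * sumAt h E v
  sumAt-* x h [] v = sym (*-zeroʳ x)
  sumAt-* x h (e ∷ E) v with lookup e v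
  ... | false = sumAt-* x h E v
  ... | true = trans (cong (x * h e +_) (sumAt-* x h E v)) (sym (*-distribˡ-+ x (h e) (sumAt h E v)))

  sumAt-nonNeg : ∀ {h} → (∀ e → 0ℚ ≤ h e) → ∀ E v → 0ℚ ≤ sumAt h E v
  sumAt-nonNeg 0≤h [] v = ≤-refl
  sumAt-nonNeg 0≤h (e ∷ E) v with lookup e v
  ... | true = +-nonNeg (0≤h e) (sumAt-nonNeg 0≤h E v)
  ... | false = sumAt-nonNeg 0≤h E v

  sumAt-const≤ : ∀ {x} → 0ℚ ≤ x → ∀ E v → sumAt (λ _ → x) E v ≤ ℕ→ℚ (length E) * x
  sumAt-const≤ {x} 0≤x [] v = ≤-reflexive (sym (*-zeroˡ x))
  sumAt-const≤ {x} 0≤x (e ∷ E) v = begin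
    sumAt (λ _ → x) (e ∷ E) v             ≡⟨ sumAt-∷ (λ _ → x) e E v ⟩
    gated e x v + sumAt (λ _ → x) E v     ≤⟨ +-mono-≤ gated≤ (sumAt-const≤ 0≤x E v) ⟩
    x + ℕ→ℚ (length E) * x                ≡⟨ factor (ℕ→ℚ (length E)) x ⟩
    (1ℚ + ℕ→ℚ (length E)) * x             ≡⟨ cong (_* x) (ℕ→ℚ-+ 1 (length E)) ⟨
    ℕ→ℚ (suc (length E)) * x              ∎
    where
    gated≤ : gated e x v ≤ x
    gated≤ with lookup e v
    ... | true = ≤-refl
    ... | false = 0≤x
    factor : ∀ k x → x + k * x ≡ (1ℚ + k) * x
    factor = solve-∀ ring

  -- Used for the moved edges: all of them contain the moved node, so counting them in the whole
  -- graph is counting them at that node.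
  total≡sumAt : ∀ {h} v → (∀ e → lookup e v ≡ false → h e ≡ 0ℚ) → ∀ E → total h E ≡ sumAt h E v
  total≡sumAt v h≡0 [] = refl
  total≡sumAt {h} v h≡0 (e ∷ E) with lookup e v in v∉e
  ... | true = cong (h e +_) (total≡sumAt v h≡0 E)
  ... | false = trans (cong₂ _+_ (h≡0 e v∉e) (total≡sumAt v h≡0 E)) (+-identityˡ (sumAt h E v))

  -- Double counting: an edge appears once for each of its endpoints, hence at most `f` times.
  sum-sumAt≤ : ∀ {h} f → (∀ e → 0ℚ ≤ h e) → ∀ {E} → All (λ e → ∣ e ∣ ℕ.≤ f) E →
               sum (sumAt h E) ≤ ℕ→ℚ f * total h E
  sum-sumAt≤ f 0≤h [] = ≤-reflexive (trans (sum-replicate-zero n) (sym (*-zeroʳ (ℕ→ℚ f))))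
  sum-sumAt≤ {h} f 0≤h {e ∷ E} (∣e∣≤f ∷ small) = begin
    sum (sumAt h (e ∷ E))                         ≡⟨ sum-cong-≗ (sumAt-∷ h e E) ⟩
    sum (λ u → gated e (h e) u + sumAt h E u)     ≡⟨ ∑-distrib-+ (gated e (h e)) (sumAt h E) ⟩
    sum (gated e (h e)) + sum (sumAt h E)         ≤⟨ +-mono-≤ (sum-gated≤ e ∣e∣≤f (0≤h e)) (sum-sumAt≤ f 0≤h small) ⟩
    ℕ→ℚ f * h e + ℕ→ℚ f * total h E               ≡⟨ *-distribˡ-+ (ℕ→ℚ f) (h e) (total h E) ⟨
    ℕ→ℚ f * (h e + total h E)                     ∎

-- Edge levels

module Edges (n f m : ℕ) (μ ε : ℚ) (c : Fin n → ℚ) where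
  open Dyn n f m μ ε c

  level≤edgeLevel : ∀ lv e {u} → lookup e u ≡ true → lv u ℕ.≤ edgeLevel lv e
  level≤edgeLevel lv e {u} u∈e = go (∈-allFin u)
    where
    go : ∀ {vs} → u ∈ vs → lv u ℕ.≤ foldr (λ v acc → (if lookup e v then lv v else 0) ℕ.⊔ acc) 0 vs
    go {v ∷ vs} (here refl) rewrite u∈e = ℕₚ.m≤m⊔n (lv u) _
    go {v ∷ vs} (there u∈vs) = ℕₚ.≤-trans (go u∈vs) (ℕₚ.m≤n⊔m (if lookup e v then lv v else 0) _)

  edgeLevel≤ : ∀ lv e {k} → (∀ u → lookup e u ≡ true → lv u ℕ.≤ k) → edgeLevel lv e ℕ.≤ k
  edgeLevel≤ lv e {k} lv≤k = go (allFin n)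
    where
    go : ∀ vs → foldr (λ v acc → (if lookup e v then lv v else 0) ℕ.⊔ acc) 0 vs ℕ.≤ k
    go [] = z≤n
    go (v ∷ vs) = ℕₚ.⊔-lub node (go vs)
      where
      node : (if lookup e v then lv v else 0) ℕ.≤ k
      node with lookup e v in v∈e
      ... | true = lv≤k v v∈e
      ... | false = z≤n

  -- A relation rather than an application of `setLevel`, so that a lowering can be treated as a
  -- raise read backwards. Undoing a change of level gives back the old assignment only pointwise,
  -- and the relation asks for no more.
  Raise : Levels → Fin n → Levels → Set
  Raise lv v lv' = lv' v ≡ suc (lv v) × (∀ u → u ≢ v → lv' u ≡ lv u)

  setLevel-same : ∀ lv v k → setLevel lv v k v ≡ k
  setLevel-same lv v k with v Fin.≟ v
  ... | yes _ = refl
  ... | no v≢v = contradiction refl v≢v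

  setLevel-other : ∀ lv v k u → u ≢ v → setLevel lv v k u ≡ lv u
  setLevel-other lv v k u u≢v with u Fin.≟ v
  ... | yes u≡v = contradiction u≡v u≢v
  ... | no _ = refl

  -- An edge level is a maximum over endpoints, so raising `v` by one affects it only if `v` is an
  -- endpoint that attains the maximum, and then the maximum grows by exactly one.
  raise-edgeLevel : ∀ {lv v lv'} → Raise lv v lv' → ∀ e →
    edgeLevel lv e ≡ edgeLevel lv' e ⊎
    (lookup e v ≡ true × edgeLevel lv e ≡ lv v × edgeLevel lv' e ≡ suc (lv v))
  raise-edgeLevel {lv} {v} {lv'} (at-v , elsewhere) e = result
    where
    lv≤lv' : ∀ u → lv u ℕ.≤ lv' u
    lv≤lv' u with u Fin.≟ v
    ... | yes refl = ℕₚ.≤-trans (ℕₚ.n≤1+n (lv v)) (ℕₚ.≤-reflexive (sym at-v))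
    ... | no u≢v = ℕₚ.≤-reflexive (sym (elsewhere u u≢v))

    grow : edgeLevel lv e ℕ.≤ edgeLevel lv' e
    grow = edgeLevel≤ lv e λ u u∈e → ℕₚ.≤-trans (lv≤lv' u) (level≤edgeLevel lv' e u∈e)

    bound : ∀ {k} → edgeLevel lv e ℕ.≤ k → (lookup e v ≡ true → suc (lv v) ℕ.≤ k) → edgeLevel lv' e ℕ.≤ k
    bound {k} ℓ≤k v<k = edgeLevel≤ lv' e node
      where
      node : ∀ u → lookup e u ≡ true → lv' u ℕ.≤ k
      node u u∈e with u Fin.≟ v
      ... | yes refl = ℕₚ.≤-trans (ℕₚ.≤-reflexive at-v) (v<k u∈e)
      ... | no u≢v = ℕₚ.≤-trans (ℕₚ.≤-reflexive (elsewhere u u≢v)) (ℕₚ.≤-trans (level≤edgeLevel lv e u∈e) ℓ≤k)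

    result : edgeLevel lv e ≡ edgeLevel lv' e ⊎
             (lookup e v ≡ true × edgeLevel lv e ≡ lv v × edgeLevel lv' e ≡ suc (lv v))
    result with lookup e v in v∈e
    ... | false = inj₁ (ℕₚ.≤-antisym grow (bound ℕₚ.≤-refl λ v∈e' → contradiction (trans (sym v∈e) v∈e') λ ()))
    ... | true with ℕₚ.m≤n⇒m<n∨m≡n (level≤edgeLevel lv e v∈e)
    -- The maximum is already at least `suc (lv v)` and absorbs the raised `v`.
    ... | inj₁ lv<ℓ = inj₁ (ℕₚ.≤-antisym grow (bound ℕₚ.≤-refl λ _ → lv<ℓ))
    ... | inj₂ lv≡ℓ = inj₂ (refl , sym lv≡ℓ , ℕₚ.≤-antisym
            (bound (ℕₚ.≤-trans (ℕₚ.≤-reflexive (sym lv≡ℓ)) (ℕₚ.n≤1+n (lv v))) λ _ → ℕₚ.≤-refl)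
            (ℕₚ.≤-trans (ℕₚ.≤-reflexive (sym at-v)) (level≤edgeLevel lv' e v∈e)))

  -- A 0-1 indicator, built from `changed` on a singleton so that its total over the edges is the
  -- increment of the counter.
  moved : Levels → Levels → Edge → ℚ
  moved lv lv' e = ℕ→ℚ (changed lv lv' (e ∷ []))

  moved-nonNeg : ∀ lv lv' e → 0ℚ ≤ moved lv lv' e
  moved-nonNeg lv lv' e = 0≤ℕ→ℚ (changed lv lv' (e ∷ []))

  changed-≡ : ∀ lv lv' e → edgeLevel lv e ≡ edgeLevel lv' e → changed lv lv' (e ∷ []) ≡ 0
  changed-≡ lv lv' e eq with edgeLevel lv e ℕ.≟ edgeLevel lv' e
  ... | yes _ = refl
  ... | no neq = contradiction eq neq

  changed-≢ : ∀ lv lv' e → edgeLevel lv e ≢ edgeLevel lv' e → changed lv lv' (e ∷ []) ≡ 1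
  changed-≢ lv lv' e neq with edgeLevel lv e ℕ.≟ edgeLevel lv' e
  ... | yes eq = contradiction eq neq
  ... | no _ = refl

  changed-∷ : ∀ lv lv' e E → changed lv lv' (e ∷ E) ≡ changed lv lv' (e ∷ []) ℕ.+ changed lv lv' E
  changed-∷ lv lv' e E with edgeLevel lv e ℕ.≟ edgeLevel lv' e
  ... | yes _ = refl
  ... | no _ = refl

  -- Lets the count for a lowering be read off from the reversed raise.
  changed-sym : ∀ lv lv' E → changed lv lv' E ≡ changed lv' lv E
  changed-sym lv lv' [] = refl
  changed-sym lv lv' (e ∷ E) with edgeLevel lv e ℕ.≟ edgeLevel lv' e | edgeLevel lv' e ℕ.≟ edgeLevel lv e
  ... | yes _ | yes _ = changed-sym lv lv' E
  ... | no _ | no _ = cong suc (changed-sym lv lv' E)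
  ... | yes eq | no neq = contradiction (sym eq) neq
  ... | no neq | yes eq = contradiction (sym eq) neq

  total-moved : ∀ lv lv' E → total (moved lv lv') E ≡ ℕ→ℚ (changed lv lv' E)
  total-moved lv lv' [] = refl
  total-moved lv lv' (e ∷ E) = begin-equality
    moved lv lv' e + total (moved lv lv') E                   ≡⟨ cong (moved lv lv' e +_) (total-moved lv lv' E) ⟩
    moved lv lv' e + ℕ→ℚ (changed lv lv' E)                   ≡⟨ ℕ→ℚ-+ (changed lv lv' (e ∷ [])) (changed lv lv' E) ⟨
    ℕ→ℚ (changed lv lv' (e ∷ []) ℕ.+ changed lv lv' E)        ≡⟨ cong ℕ→ℚ (changed-∷ lv lv' e E) ⟨
    ℕ→ℚ (changed lv lv' (e ∷ E))                              ∎

  total-remove : ∀ h {e E} → e ∈ E → total h E ≡ h e + total h (remove e E)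
  total-remove h {e} {e' ∷ E} e∈E with VecP.≡-dec BoolP._≟_ e e' | e∈E
  ... | yes refl | _ = refl
  ... | no e≢e' | here e≡e' = contradiction e≡e' e≢e'
  ... | no _ | there e∈E' = trans (cong (h e' +_) (total-remove h e∈E')) (swap (h e') (h e) (total h (remove e E)))
    where
    swap : ∀ a b c → a + (b + c) ≡ b + (a + c)
    swap = solve-∀ ring

  sumAt-remove : ∀ h u {e E} → e ∈ E → sumAt h E u ≡ gated e (h e) u + sumAt h (remove e E) u
  sumAt-remove h u {e} {e' ∷ E} e∈E with VecP.≡-dec BoolP._≟_ e e' | e∈E
  ... | yes refl | _ = sumAt-∷ h e E u
  ... | no e≢e' | here e≡e' = contradiction e≡e' e≢e'
  ... | no _ | there e∈E' = begin-equality
    sumAt h (e' ∷ E) u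
      ≡⟨ sumAt-∷ h e' E u ⟩
    gated e' (h e') u + sumAt h E u
      ≡⟨ cong (gated e' (h e') u +_) (sumAt-remove h u e∈E') ⟩
    gated e' (h e') u + (gated e (h e) u + sumAt h (remove e E) u)
      ≡⟨ swap (gated e' (h e') u) (gated e (h e) u) (sumAt h (remove e E) u) ⟩
    gated e (h e) u + (gated e' (h e') u + sumAt h (remove e E) u)
      ≡⟨ cong (gated e (h e) u +_) (sumAt-∷ h e' (remove e E) u) ⟨
    gated e (h e) u + sumAt h (e' ∷ remove e E) u ∎
    where
    swap : ∀ a b c → a + (b + c) ≡ b + (a + c)
    swap = solve-∀ ring

  length-remove≤ : ∀ e E → length (remove e E) ℕ.≤ length E
  length-remove≤ e [] = z≤n
  length-remove≤ e (e' ∷ E) with VecP.≡-dec BoolP._≟_ e e'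
  ... | yes _ = ℕₚ.n≤1+n (length E)
  ... | no _ = s≤s (length-remove≤ e E)

  All-remove : ∀ {P : Edge → Set} e {E} → All P E → All P (remove e E)
  All-remove e [] = []
  All-remove e {e' ∷ E} (p ∷ ps) with VecP.≡-dec BoolP._≟_ e e'
  ... | yes _ = ps
  ... | no _ = p ∷ All-remove e ps

-- The potential

module Amortised
  (n f m : ℕ) (μ ϵ : ℚ) (c : Fin n → ℚ) (cmin : ℚ) (L : ℕ)
  (0<ϵ : 0ℚ < ϵ) (ϵ<1 : ϵ < 1ℚ) (1≤μ : 1ℚ ≤ μ) (1≤f : 1 ℕ.≤ f)
  (cmin≤c : ∀ v → cmin ≤ c v) (0<cmin : 0ℚ < cmin)
  (mμα/cmin≤β^L : ℕ→ℚ m * μ * Dyn.α n f m μ ϵ c * inv cmin ≤ pow (Dyn.β n f m μ ϵ c) L)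
  where

  open Dyn n f m μ ϵ c
  open Edges n f m μ ϵ c

  F K : ℚ
  F = ℕ→ℚ f
  K = F * μ

  0≤ϵ : 0ℚ ≤ ϵ
  0≤ϵ = <⇒≤ 0<ϵ

  0<1 : 0ℚ < 1ℚ
  0<1 = positive⁻¹ 1ℚ

  0<μ : 0ℚ < μ
  0<μ = <-≤-trans 0<1 1≤μ

  0≤μ : 0ℚ ≤ μ
  0≤μ = <⇒≤ 0<μ

  0<F : 0ℚ < F
  0<F = <-≤-trans 0<1 (ℕ→ℚ-mono-≤ 1≤f)

  0<K : 0ℚ < K
  0<K = *-pos 0<F 0<μ

  0≤K : 0ℚ ≤ K
  0≤K = <⇒≤ 0<K

  0<β : 0ℚ < β
  0<β = +-mono-<-≤ 0<1 0≤ϵ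

  1≤α : 1ℚ ≤ α
  1≤α = ≤-trans (p≤p+q (inv-nonNeg 0<F)) (p≤p+q (*-nonNeg (0≤ℕ→ℚ 3) 0≤ϵ))

  0<α : 0ℚ < α
  0<α = <-≤-trans 0<1 1≤α

  0<fαβ : 0ℚ < fαβ
  0<fαβ = *-pos (*-pos 0<F 0<α) 0<β

  open Powers {ϵ} {inv β} 0≤ϵ (inv-nonNeg 0<β) (inv-inverseʳ 0<β)

  powb-nonNeg : ∀ l → 0ℚ ≤ pow (inv β) l
  powb-nonNeg = pow-nonNeg (inv-nonNeg 0<β)

  fαβ*c*≡c : ∀ v → fαβ * c* v ≡ c v
  fαβ*c*≡c v = begin-equality
    fαβ * (c v * inv fαβ)    ≡⟨ swap fαβ (c v) (inv fαβ) ⟩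
    c v * (fαβ * inv fαβ)    ≡⟨ cong (c v *_) (inv-inverseʳ 0<fαβ) ⟩
    c v * 1ℚ                 ≡⟨ *-identityʳ (c v) ⟩
    c v                      ∎
    where
    swap : ∀ x y z → x * (y * z) ≡ y * (x * z)
    swap = solve-∀ ring

  -- Isolates the role of 1/f in `α`: it leaves fα - 1 = f(1 + 3ϵ), which is the gap between
  -- `target v` and `c* v` in units of `c* v`. Lowering a node draws on this gap.
  F*α : F * α ≡ F * (1ℚ + ℕ→ℚ 3 * ϵ) + 1ℚ
  F*α = trans (expand F (inv F) (ℕ→ℚ 3 * ϵ)) (cong (F * (1ℚ + ℕ→ℚ 3 * ϵ) +_) (inv-inverseʳ 0<F))
    where
    expand : ∀ F i x → F * (1ℚ + i + x) ≡ F * (1ℚ + x) + F * i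
    expand = solve-∀ ring

  weight-nonNeg : ∀ lv e → 0ℚ ≤ weight lv e
  weight-nonNeg lv e = *-nonNeg 0≤μ (powb-nonNeg (edgeLevel lv e))

  weight≤ : ∀ lv e {k} → k ℕ.≤ edgeLevel lv e → weight lv e ≤ μ * pow (inv β) k
  weight≤ lv e k≤ℓ = *-mono-≤ˡ 0≤μ (powb-antimono k≤ℓ)

  W≤c-at-top : ∀ E lv {v} → length E ℕ.≤ m → L ℕ.≤ lv v → W E lv v ≤ c v
  W≤c-at-top E lv {v} short L≤lv = begin
    sumAt (weight lv) E v             ≤⟨ sumAt-mono-≤ v (λ e v∈e → weight≤ lv e (ℕₚ.≤-trans L≤lv (level≤edgeLevel lv e v∈e))) E ⟩
    sumAt (λ _ → μ * Q) E v           ≤⟨ sumAt-const≤ (*-nonNeg 0≤μ 0≤Q) E v ⟩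
    ℕ→ℚ (length E) * (μ * Q)          ≤⟨ *-mono-≤ʳ (*-nonNeg 0≤μ 0≤Q) (ℕ→ℚ-mono-≤ short) ⟩
    M * (μ * Q)                       ≡⟨ unit M μ Q ⟩
    -- The factor `α`, and then `cmin * inv cmin`, are inserted to reach the quantity whose
    -- logarithm defines `L`.
    M * μ * Q * 1ℚ                    ≤⟨ *-mono-≤ˡ (*-nonNeg (*-nonNeg (0≤ℕ→ℚ m) 0≤μ) 0≤Q) 1≤α ⟩
    M * μ * Q * α                     ≡⟨ *-identityʳ (M * μ * Q * α) ⟨
    M * μ * Q * α * 1ℚ                ≡⟨ cong (M * μ * Q * α *_) (inv-inverseʳ 0<cmin) ⟨
    M * μ * Q * α * (cmin * inv cmin) ≡⟨ regroup M μ Q α cmin (inv cmin) ⟩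
    M * μ * α * inv cmin * (cmin * Q) ≤⟨ *-mono-≤ʳ (*-nonNeg (<⇒≤ 0<cmin) 0≤Q) mμα/cmin≤β^L ⟩
    pow β L * (cmin * Q)              ≡⟨ pull (pow β L) cmin Q ⟩
    cmin * (pow β L * Q)              ≡⟨ cong (cmin *_) (powβ*powb L) ⟩
    cmin * 1ℚ                         ≡⟨ *-identityʳ cmin ⟩
    cmin                              ≤⟨ cmin≤c v ⟩
    c v                               ∎
    where
    M = ℕ→ℚ m
    Q = pow (inv β) L
    0≤Q = powb-nonNeg L
    unit : ∀ M μ Q → M * (μ * Q) ≡ M * μ * Q * 1ℚ
    unit = solve-∀ ring
    regroup : ∀ M μ Q α x y → M * μ * Q * α * (x * y) ≡ M * μ * α * y * (x * Q)
    regroup = solve-∀ ring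
    pull : ∀ p x q → p * (x * q) ≡ x * (p * q)
    pull = solve-∀ ring

  -- A factor β below the upper threshold `fαβ * c* v`. One raise divides a node weight by at most
  -- β, so a node raised for being overweight still meets its target.
  target : Fin n → ℚ
  target v = F * α * c* v

  β*target : ∀ v → β * target v ≡ fαβ * c* v
  β*target v = commute β (F * α) (c* v)
    where
    commute : ∀ x y z → x * (y * z) ≡ y * x * z
    commute = solve-∀ ring

  slack : Levels → Edge → ℚ
  slack lv e = ℕ→ℚ (L ℕ.∸ edgeLevel lv e)

  nodePotential : List Edge → Levels → Fin n → ℚ
  nodePotential E lv u = geo (lv u) * deficit (target u) (W E lv u)

  potential : List Edge → Levels → ℚ
  potential E lv = K * (1ℚ + ϵ) * total (slack lv) E + sum (nodePotential E lv)

  -- Moving one node by one level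

  module _ {lv v lv'} (raise : Raise lv v lv') where

    Moves : Edge → Set
    Moves e = lookup e v ≡ true × edgeLevel lv e ≡ lv v × edgeLevel lv' e ≡ suc (lv v)

    moved-stays : ∀ e → edgeLevel lv e ≡ edgeLevel lv' e → moved lv lv' e ≡ 0ℚ
    moved-stays e same = cong ℕ→ℚ (changed-≡ lv lv' e same)

    moved-moves : ∀ e → Moves e → moved lv lv' e ≡ 1ℚ
    moved-moves e (_ , low , high) = cong ℕ→ℚ (changed-≢ lv lv' e λ same → ℕₚ.1+n≢n (trans (sym high) (trans (sym same) low)))

    by-cases : ∀ {P : Edge → Set} → (∀ e → edgeLevel lv e ≡ edgeLevel lv' e → P e) → (∀ e → Moves e → P e) → ∀ e → P e
    by-cases stays moves e = [ stays e , moves e ]′ (raise-edgeLevel raise e)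

    weight-stays : ∀ e → edgeLevel lv e ≡ edgeLevel lv' e → weight lv e ≡ weight lv' e
    weight-stays e = cong (λ k → μ * pow (inv β) k)

    weight-before : ∀ e → Moves e → weight lv e ≡ μ * pow (inv β) (lv v)
    weight-before e (_ , low , _) = cong (λ k → μ * pow (inv β) k) low

    weight-after : ∀ e → Moves e → weight lv' e ≡ μ * pow (inv β) (suc (lv v))
    weight-after e (_ , _ , high) = cong (λ k → μ * pow (inv β) k) high

    moved-outside : ∀ e → lookup e v ≡ false → moved lv lv' e ≡ 0ℚ
    moved-outside = by-cases {λ e → lookup e v ≡ false → moved lv lv' e ≡ 0ℚ} (λ e same _ → moved-stays e same)
      λ e (v∈e , _) v∉e → contradiction (trans (sym v∈e) v∉e) λ ()

    slack-raise : lv v ℕ.< L → ∀ e → slack lv e ≡ slack lv' e + moved lv lv' e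
    slack-raise lv<L = by-cases {λ e → slack lv e ≡ slack lv' e + moved lv lv' e} stays moves
      where
      stays : ∀ e → edgeLevel lv e ≡ edgeLevel lv' e → slack lv e ≡ slack lv' e + moved lv lv' e
      stays e same = begin-equality
        slack lv e                      ≡⟨ cong (λ k → ℕ→ℚ (L ℕ.∸ k)) same ⟩
        slack lv' e                     ≡⟨ +-identityʳ (slack lv' e) ⟨
        slack lv' e + 0ℚ                ≡⟨ cong (slack lv' e +_) (moved-stays e same) ⟨
        slack lv' e + moved lv lv' e    ∎
      moves : ∀ e → Moves e → slack lv e ≡ slack lv' e + moved lv lv' e
      moves e mv@(_ , low , high) = begin-equality
        slack lv e                           ≡⟨ cong (λ k → ℕ→ℚ (L ℕ.∸ k)) low ⟩
        -- The truncated subtraction is exact here because `lv v` is below `L`.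
        ℕ→ℚ (L ℕ.∸ lv v)                     ≡⟨ cong ℕ→ℚ (ℕₚ.+-∸-assoc 1 lv<L) ⟩
        ℕ→ℚ (suc (L ℕ.∸ suc (lv v)))         ≡⟨ ℕ→ℚ-+ 1 (L ℕ.∸ suc (lv v)) ⟩
        1ℚ + ℕ→ℚ (L ℕ.∸ suc (lv v))          ≡⟨ +-comm 1ℚ (ℕ→ℚ (L ℕ.∸ suc (lv v))) ⟩
        ℕ→ℚ (L ℕ.∸ suc (lv v)) + 1ℚ          ≡⟨ cong₂ _+_ (cong (λ k → ℕ→ℚ (L ℕ.∸ k)) high) (moved-moves e mv) ⟨
        slack lv' e + moved lv lv' e         ∎

    total-slack-raise : lv v ℕ.< L → ∀ E → total (slack lv) E ≡ total (slack lv') E + ℕ→ℚ (changed lv lv' E)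
    total-slack-raise lv<L E = begin-equality
      -- Pointwise equality of the summands becomes equality of the totals by monotonicity in both
      -- directions.
      total (slack lv) E                                  ≡⟨ ≤-antisym (total-mono-≤ (≤-reflexive ∘ slack-raise lv<L) E) (total-mono-≤ (≤-reflexive ∘ sym ∘ slack-raise lv<L) E) ⟩
      total (λ e → slack lv' e + moved lv lv' e) E        ≡⟨ total-+ (slack lv') (moved lv lv') E ⟩
      total (slack lv') E + total (moved lv lv') E        ≡⟨ cong (total (slack lv') E +_) (total-moved lv lv' E) ⟩
      total (slack lv') E + ℕ→ℚ (changed lv lv' E)        ∎

    weight-raise≤ : ∀ e → weight lv' e ≤ weight lv e
    weight-raise≤ = by-cases {λ e → weight lv' e ≤ weight lv e}
      (λ e same → ≤-reflexive (sym (weight-stays e same)))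
      λ e mv → subst₂ _≤_ (sym (weight-after e mv)) (sym (weight-before e mv)) (*-mono-≤ˡ 0≤μ (powb-suc≤ (lv v)))

    weight≤β*raised : ∀ e → weight lv e ≤ β * weight lv' e
    weight≤β*raised = by-cases {λ e → weight lv e ≤ β * weight lv' e} stays moves
      where
      collect : ∀ x w → w + x * w ≡ (1ℚ + x) * w
      collect = solve-∀ ring
      swap : ∀ x y z → x * (y * z) ≡ y * (x * z)
      swap = solve-∀ ring
      stays : ∀ e → edgeLevel lv e ≡ edgeLevel lv' e → weight lv e ≤ β * weight lv' e
      stays e same = begin
        weight lv e                         ≡⟨ weight-stays e same ⟩
        weight lv' e                        ≤⟨ p≤p+q (*-nonNeg 0≤ϵ (weight-nonNeg lv' e)) ⟩
        weight lv' e + ϵ * weight lv' e     ≡⟨ collect ϵ (weight lv' e) ⟩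
        β * weight lv' e                    ∎
      moves : ∀ e → Moves e → weight lv e ≤ β * weight lv' e
      moves e mv = ≤-reflexive (begin-equality
        weight lv e                            ≡⟨ weight-before e mv ⟩
        μ * pow (inv β) (lv v)                 ≡⟨ cong (μ *_) (β*powb (lv v)) ⟨
        μ * (β * pow (inv β) (suc (lv v)))     ≡⟨ swap μ β (pow (inv β) (suc (lv v))) ⟩
        β * (μ * pow (inv β) (suc (lv v)))     ≡⟨ cong (β *_) (weight-after e mv) ⟨
        β * weight lv' e                       ∎)

    -- In `lv'` a moved edge has exactly the level of `v`, so the left side is its weight there, and
    -- 0 for every other edge. The weights are those of `lv'` because this is the assignment from
    -- which a lowering starts.
    moved-weight≤ : ∀ e → μ * pow (inv β) (lv' v) * moved lv lv' e ≤ weight lv' e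
    moved-weight≤ = by-cases {λ e → q * moved lv lv' e ≤ weight lv' e} stays moves
      where
      q = μ * pow (inv β) (lv' v)
      stays : ∀ e → edgeLevel lv e ≡ edgeLevel lv' e → q * moved lv lv' e ≤ weight lv' e
      stays e same = begin
        q * moved lv lv' e     ≡⟨ cong (q *_) (moved-stays e same) ⟩
        q * 0ℚ                 ≡⟨ *-zeroʳ q ⟩
        0ℚ                     ≤⟨ weight-nonNeg lv' e ⟩
        weight lv' e           ∎
      moves : ∀ e → Moves e → q * moved lv lv' e ≤ weight lv' e
      moves e mv = ≤-reflexive (begin-equality
        q * moved lv lv' e     ≡⟨ cong (q *_) (moved-moves e mv) ⟩
        q * 1ℚ                 ≡⟨ *-identityʳ q ⟩
        q                      ≡⟨ cong (λ k → μ * pow (inv β) k) (proj₁ raise) ⟩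
        μ * pow (inv β) (suc (lv v)) ≡⟨ weight-after e mv ⟨
        weight lv' e           ∎)

    -- With l = `lv v`, a moved edge loses weight μϵβ^-(l+1). Its endpoint `u` has level at most l,
    -- since the edge had level l, so the loss stays at most `μ` after scaling by `geo (lv u)`.
    geo-weight-raise : ∀ u e → lookup e u ≡ true →
      geo (lv u) * weight lv e ≤ geo (lv u) * weight lv' e + μ * moved lv lv' e
    geo-weight-raise u = by-cases {λ e → lookup e u ≡ true → g * weight lv e ≤ g * weight lv' e + μ * moved lv lv' e} stays moves
      where
      g = geo (lv u)
      Q = pow (inv β) (suc (lv v))
      split : ∀ g μ x Q → g * (μ * ((1ℚ + x) * Q)) ≡ g * (μ * Q) + μ * (x * g * Q)
      split = solve-∀ ring
      stays : ∀ e → edgeLevel lv e ≡ edgeLevel lv' e → lookup e u ≡ true →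
              g * weight lv e ≤ g * weight lv' e + μ * moved lv lv' e
      stays e same _ = begin
        g * weight lv e                           ≡⟨ cong (g *_) (weight-stays e same) ⟩
        g * weight lv' e                          ≤⟨ p≤p+q (*-nonNeg 0≤μ (moved-nonNeg lv lv' e)) ⟩
        g * weight lv' e + μ * moved lv lv' e     ∎
      moves : ∀ e → Moves e → lookup e u ≡ true →
              g * weight lv e ≤ g * weight lv' e + μ * moved lv lv' e
      moves e mv@(_ , low , _) u∈e = begin
        g * weight lv e                           ≡⟨ cong (g *_) (weight-before e mv) ⟩
        g * (μ * pow (inv β) (lv v))              ≡⟨ cong (λ x → g * (μ * x)) (β*powb (lv v)) ⟨
        g * (μ * (β * Q))                         ≡⟨ split g μ ϵ Q ⟩
        g * (μ * Q) + μ * (ϵ * g * Q)             ≤⟨ +-monoʳ-≤ (g * (μ * Q)) (*-mono-≤ˡ 0≤μ loss≤1) ⟩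
        g * (μ * Q) + μ * 1ℚ                      ≡⟨ cong₂ (λ w x → g * w + μ * x) (weight-after e mv) (moved-moves e mv) ⟨
        g * weight lv' e + μ * moved lv lv' e     ∎
        where
        lvu≤lvv : lv u ℕ.≤ lv v
        lvu≤lvv = ℕₚ.≤-trans (level≤edgeLevel lv e u∈e) (ℕₚ.≤-reflexive low)
        loss≤1 : ϵ * g * Q ≤ 1ℚ
        loss≤1 = ≤-trans (*-mono-≤ˡ (*-nonNeg 0≤ϵ (geo-nonNeg (lv u))) (powb-antimono (s≤s lvu≤lvv))) (ε*geo*powb≤1 (lv u))

    W≤β*raised : ∀ E u → W E lv u ≤ β * W E lv' u
    W≤β*raised E u = begin
      sumAt (weight lv) E u                   ≤⟨ sumAt-mono-≤ u (λ e _ → weight≤β*raised e) E ⟩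
      sumAt (λ e → β * weight lv' e) E u      ≡⟨ sumAt-* β (weight lv') E u ⟩
      β * W E lv' u                           ∎

    geo-W-raise : ∀ E u → geo (lv u) * W E lv u ≤ geo (lv u) * W E lv' u + μ * sumAt (moved lv lv') E u
    geo-W-raise E u = begin
      g * sumAt (weight lv) E u                                                    ≡⟨ sumAt-* g (weight lv) E u ⟨
      sumAt (λ e → g * weight lv e) E u                                            ≤⟨ sumAt-mono-≤ u (geo-weight-raise u) E ⟩
      sumAt (λ e → g * weight lv' e + μ * moved lv lv' e) E u                      ≡⟨ sumAt-+ (λ e → g * weight lv' e) (λ e → μ * moved lv lv' e) E u ⟩
      sumAt (λ e → g * weight lv' e) E u + sumAt (λ e → μ * moved lv lv' e) E u    ≡⟨ cong₂ _+_ (sumAt-* g (weight lv') E u) (sumAt-* μ (moved lv lv') E u) ⟩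
      g * sumAt (weight lv') E u + μ * sumAt (moved lv lv') E u                    ∎
      where
      g = geo (lv u)

    -- The raised node still meets its target, so its term is 0 whatever the growth of its `geo`
    -- factor. Any other node keeps its factor and pays only for the weight lost by its moved edges.
    nodePotential-raise : ∀ E → fαβ * c* v < W E lv v → ∀ u →
      nodePotential E lv' u ≤ nodePotential E lv u + μ * sumAt (moved lv lv') E u
    nodePotential-raise E heavy u = by-node (u Fin.≟ v)
      where
      target≤W' : target v ≤ W E lv' v
      target≤W' = *-cancelˡ-≤-pos β {{positive 0<β}} (begin
        β * target v     ≡⟨ β*target v ⟩
        fαβ * c* v       ≤⟨ <⇒≤ heavy ⟩
        W E lv v         ≤⟨ W≤β*raised E v ⟩
        β * W E lv' v    ∎)
      0≤δ : 0ℚ ≤ μ * sumAt (moved lv lv') E u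
      0≤δ = *-nonNeg 0≤μ (sumAt-nonNeg (moved-nonNeg lv lv') E u)
      by-node : Dec (u ≡ v) → nodePotential E lv' u ≤ nodePotential E lv u + μ * sumAt (moved lv lv') E u
      by-node (no u≢v) = begin
        nodePotential E lv' u                              ≡⟨ cong (λ l → geo l * deficit (target u) (W E lv' u)) (proj₂ raise u u≢v) ⟩
        geo (lv u) * deficit (target u) (W E lv' u)        ≤⟨ deficit-lipschitz (target u) (geo-nonNeg (lv u)) 0≤δ (geo-W-raise E u) ⟩
        nodePotential E lv u + μ * sumAt (moved lv lv') E u ∎
      by-node (yes refl) = begin
        geo (lv' v) * deficit (target v) (W E lv' v)       ≡⟨ cong (geo (lv' v) *_) (deficit-zero target≤W') ⟩
        geo (lv' v) * 0ℚ                                   ≡⟨ *-zeroʳ (geo (lv' v)) ⟩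
        0ℚ                                                 ≤⟨ +-nonNeg (*-nonNeg (geo-nonNeg (lv v)) (0≤deficit (target v) (W E lv v))) 0≤δ ⟩
        nodePotential E lv v + μ * sumAt (moved lv lv') E v ∎

    -- The edge terms free `K * (1ℚ + ϵ)` per moved edge. The node terms take back at most `K`,
    -- namely `μ` at each of at most `f` endpoints. The remaining `K * ϵ` pays for the counter.
    potential-up : ∀ E → lv v ℕ.< L → All (λ e → ∣ e ∣ ℕ.≤ f) E → fαβ * c* v < W E lv v →
      K * ϵ * ℕ→ℚ (changed lv lv' E) + potential E lv' ≤ potential E lv
    potential-up E lv<L small heavy = begin
      K * ϵ * x + (K * (1ℚ + ϵ) * S' + sum (nodePotential E lv'))           ≤⟨ +-monoʳ-≤ (K * ϵ * x) (+-monoʳ-≤ (K * (1ℚ + ϵ) * S') nodes) ⟩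
      K * ϵ * x + (K * (1ℚ + ϵ) * S' + (sum (nodePotential E lv) + K * x))  ≡⟨ collect K ϵ x S' (sum (nodePotential E lv)) ⟩
      K * (1ℚ + ϵ) * (S' + x) + sum (nodePotential E lv)                    ≡⟨ cong (λ s → K * (1ℚ + ϵ) * s + sum (nodePotential E lv)) (total-slack-raise lv<L E) ⟨
      potential E lv                                                        ∎
      where
      x = ℕ→ℚ (changed lv lv' E)
      S' = total (slack lv') E
      mv = λ e → μ * moved lv lv' e
      collect : ∀ K ϵ x S p → K * ϵ * x + (K * (1ℚ + ϵ) * S + (p + K * x)) ≡ K * (1ℚ + ϵ) * (S + x) + p
      collect = solve-∀ ring
      scale : ∀ E → total mv E ≡ μ * total (moved lv lv') E
      scale [] = sym (*-zeroʳ μ)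
      scale (e ∷ E) = trans (cong (mv e +_) (scale E)) (sym (*-distribˡ-+ μ (moved lv lv' e) (total (moved lv lv') E)))
      nodes : sum (nodePotential E lv') ≤ sum (nodePotential E lv) + K * x
      nodes = begin
        sum (nodePotential E lv')                                       ≤⟨ sum-mono-≤ (nodePotential-raise E heavy) ⟩
        sum (λ u → nodePotential E lv u + μ * sumAt (moved lv lv') E u) ≡⟨ sum-cong-≗ (λ u → cong (nodePotential E lv u +_) (sumAt-* μ (moved lv lv') E u)) ⟨
        sum (λ u → nodePotential E lv u + sumAt mv E u)                 ≡⟨ ∑-distrib-+ (nodePotential E lv) (sumAt mv E) ⟩
        sum (nodePotential E lv) + sum (sumAt mv E)                     ≤⟨ +-monoʳ-≤ (sum (nodePotential E lv)) (sum-sumAt≤ f (λ e → *-nonNeg 0≤μ (moved-nonNeg lv lv' e)) small) ⟩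
        sum (nodePotential E lv) + F * total mv E                       ≡⟨ cong (λ y → sum (nodePotential E lv) + F * y) (scale E) ⟩
        sum (nodePotential E lv) + F * (μ * total (moved lv lv') E)     ≡⟨ cong (λ y → sum (nodePotential E lv) + F * (μ * y)) (total-moved lv lv' E) ⟩
        sum (nodePotential E lv) + F * (μ * x)                          ≡⟨ cong (sum (nodePotential E lv) +_) (*-assoc F μ x) ⟨
        sum (nodePotential E lv) + K * x                                ∎

    -- The moved edges all contain `v` and have the same weight in `lv'`, so a light node has only
    -- few of them.
    changed*weight≤W : ∀ E → μ * pow (inv β) (lv' v) * ℕ→ℚ (changed lv lv' E) ≤ W E lv' v
    changed*weight≤W E = begin
      q * ℕ→ℚ (changed lv lv' E)                ≡⟨ cong (q *_) (total-moved lv lv' E) ⟨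
      q * total (moved lv lv') E                ≡⟨ cong (q *_) (total≡sumAt v moved-outside E) ⟩
      q * sumAt (moved lv lv') E v              ≡⟨ sumAt-* q (moved lv lv') E v ⟨
      sumAt (λ e → q * moved lv lv' e) E v      ≤⟨ sumAt-mono-≤ v (λ e _ → moved-weight≤ e) E ⟩
      W E lv' v                                 ∎
      where
      q = μ * pow (inv β) (lv' v)

    W-raise≤ : ∀ E u → W E lv' u ≤ W E lv u
    W-raise≤ E u = sumAt-mono-≤ u (λ e _ → weight-raise≤ e) E

    -- Lightness of `v` is used twice. The deficit is at least `target v - c* v`, which is f(1 + 3ϵ)
    -- times `c* v`; and `c* v` exceeds the weight of the moved edges. The factor `pow β (lv' v)`
    -- turns that weight into `μ` times their number.
    released : ∀ E → W E lv' v < c* v →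
      K * (1ℚ + ℕ→ℚ 2 * ϵ) * ℕ→ℚ (changed lv lv' E) ≤ pow β (lv' v) * deficit (target v) (W E lv' v)
    released E light = begin
      -- The coefficient 1 + 2ϵ is what `potential-down` spends: 1 + ϵ on the edge terms and ϵ on
      -- the counter. It is enlarged to the 1 + 3ϵ supplied by `F*α`.
      K * (1ℚ + ℕ→ℚ 2 * ϵ) * x                        ≤⟨ p≤p+q (*-nonNeg (*-nonNeg 0≤K 0≤ϵ) (0≤ℕ→ℚ (changed lv lv' E))) ⟩
      K * (1ℚ + ℕ→ℚ 2 * ϵ) * x + K * ϵ * x            ≡⟨ thrice K ϵ x ⟩
      K * R * x                                       ≡⟨ *-identityʳ (K * R * x) ⟨
      K * R * x * 1ℚ                                  ≡⟨ cong (K * R * x *_) (powβ*powb (lv' v)) ⟨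
      F * μ * R * x * (P * Q)                         ≡⟨ regroup F μ R x P Q ⟩
      P * (F * R * (μ * Q * x))                       ≤⟨ *-mono-≤ˡ 0≤P (*-mono-≤ˡ 0≤FR (≤-trans (changed*weight≤W E) (<⇒≤ light))) ⟩
      P * (F * R * c* v)                              ≡⟨ cong (P *_) target-c* ⟨
      P * (target v - c* v)                           ≤⟨ *-mono-≤ˡ 0≤P (+-monoʳ-≤ (target v) (neg-antimono-≤ (<⇒≤ light))) ⟩
      P * (target v - W E lv' v)                      ≤⟨ *-mono-≤ˡ 0≤P (A-x≤deficit (target v) (W E lv' v)) ⟩
      P * deficit (target v) (W E lv' v)              ∎
      where
      x = ℕ→ℚ (changed lv lv' E)
      P = pow β (lv' v)
      Q = pow (inv β) (lv' v)
      R = 1ℚ + ℕ→ℚ 3 * ϵ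
      0≤P = pow-nonNeg 0≤β (lv' v)
      0≤FR : 0ℚ ≤ F * R
      0≤FR = *-nonNeg (<⇒≤ 0<F) (+-nonNeg 0≤1 (*-nonNeg (0≤ℕ→ℚ 3) 0≤ϵ))
      thrice : ∀ K ϵ x → K * (1ℚ + ℕ→ℚ 2 * ϵ) * x + K * ϵ * x ≡ K * (1ℚ + ℕ→ℚ 3 * ϵ) * x
      thrice = solve-∀ ring
      regroup : ∀ F μ R x P Q → F * μ * R * x * (P * Q) ≡ P * (F * R * (μ * Q * x))
      regroup = solve-∀ ring
      cancel : ∀ y c → (y + 1ℚ) * c - c ≡ y * c
      cancel = solve-∀ ring
      target-c* : target v - c* v ≡ F * R * c* v
      target-c* = trans (cong (λ y → y * c* v - c* v) F*α) (cancel (F * R) (c* v))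

    -- Here `lv'` is the assignment before the lowering and `lv` the one after it. Weights only
    -- increase, so no deficit grows, and `v` gives up the top summand of its `geo` factor; by
    -- `released` this pays for the edge terms and the counter.
    potential-down : ∀ E → lv v ℕ.< L → W E lv' v < c* v →
      K * ϵ * ℕ→ℚ (changed lv lv' E) + potential E lv ≤ potential E lv'
    potential-down E lv<L light = begin
      K * ϵ * x + (K * (1ℚ + ϵ) * total (slack lv) E + p)        ≡⟨ cong (λ s → K * ϵ * x + (K * (1ℚ + ϵ) * s + p)) (total-slack-raise lv<L E) ⟩
      K * ϵ * x + (K * (1ℚ + ϵ) * (S' + x) + p)                  ≡⟨ collect K ϵ x S' p ⟩
      K * (1ℚ + ϵ) * S' + (p + K * (1ℚ + ℕ→ℚ 2 * ϵ) * x)         ≤⟨ +-monoʳ-≤ (K * (1ℚ + ϵ) * S') (sum-mono-gain v others gain) ⟩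
      potential E lv'                                            ∎
      where
      x = ℕ→ℚ (changed lv lv' E)
      S' = total (slack lv') E
      p = sum (nodePotential E lv)
      collect : ∀ K ϵ x S p → K * ϵ * x + (K * (1ℚ + ϵ) * (S + x) + p) ≡ K * (1ℚ + ϵ) * S + (p + K * (1ℚ + ℕ→ℚ 2 * ϵ) * x)
      collect = solve-∀ ring
      others : ∀ u → u ≢ v → nodePotential E lv u ≤ nodePotential E lv' u
      others u u≢v = begin
        geo (lv u) * deficit (target u) (W E lv u)       ≤⟨ *-mono-≤ˡ (geo-nonNeg (lv u)) (deficit-antimono (target u) (W-raise≤ E u)) ⟩
        geo (lv u) * deficit (target u) (W E lv' u)      ≡⟨ cong (λ l → geo l * deficit (target u) (W E lv' u)) (proj₂ raise u u≢v) ⟨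
        nodePotential E lv' u                            ∎
      D = deficit (target v) (W E lv' v)
      geo-lv' : geo (lv' v) ≡ pow β (lv' v) + geo (lv v)
      geo-lv' = trans (cong geo (proj₁ raise)) (cong (λ k → pow β k + geo (lv v)) (sym (proj₁ raise)))
      gain : nodePotential E lv v + K * (1ℚ + ℕ→ℚ 2 * ϵ) * x ≤ nodePotential E lv' v
      gain = begin
        nodePotential E lv v + K * (1ℚ + ℕ→ℚ 2 * ϵ) * x      ≤⟨ +-mono-≤ (*-mono-≤ˡ (geo-nonNeg (lv v)) (deficit-antimono (target v) (W-raise≤ E v))) (released E light) ⟩
        geo (lv v) * D + pow β (lv' v) * D                   ≡⟨ fold (geo (lv v)) (pow β (lv' v)) D ⟩
        (pow β (lv' v) + geo (lv v)) * D                     ≡⟨ cong (_* D) geo-lv' ⟨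
        geo (lv' v) * D                                      ∎
        where
        fold : ∀ a b d → a * d + b * d ≡ (b + a) * d
        fold = solve-∀ ring

  -- The cost of an insertion or a deletion

  slack-nonNeg : ∀ lv e → 0ℚ ≤ slack lv e
  slack-nonNeg lv e = 0≤ℕ→ℚ (L ℕ.∸ edgeLevel lv e)

  K[1+ϵ]-nonNeg : 0ℚ ≤ K * (1ℚ + ϵ)
  K[1+ϵ]-nonNeg = *-nonNeg 0≤K 0≤β

  Λ : ℚ
  Λ = ℕ→ℚ L

  0≤Λ : 0ℚ ≤ Λ
  0≤Λ = 0≤ℕ→ℚ L

  -- Weights only grow, so the node terms do not. The new edge brings at most `L` units of slack at
  -- rate `K * (1ℚ + ϵ)`, which is at most 2K as `ϵ` is below 1.
  potential-insert : ∀ E lv e → potential (e ∷ E) lv ≤ potential E lv + K * (ℕ→ℚ 2 * Λ)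
  potential-insert E lv e = begin
    K * (1ℚ + ϵ) * (slack lv e + S) + sum (nodePotential (e ∷ E) lv)   ≡⟨ cong (_+ sum (nodePotential (e ∷ E) lv)) (expand (K * (1ℚ + ϵ)) (slack lv e) S) ⟩
    K * (1ℚ + ϵ) * S + K * (1ℚ + ϵ) * slack lv e + sum (nodePotential (e ∷ E) lv)
      ≤⟨ +-mono-≤ (+-monoʳ-≤ (K * (1ℚ + ϵ) * S) charge) (sum-mono-≤ nodes) ⟩
    K * (1ℚ + ϵ) * S + K * (ℕ→ℚ 2 * Λ) + sum (nodePotential E lv)      ≡⟨ swap (K * (1ℚ + ϵ) * S) (K * (ℕ→ℚ 2 * Λ)) (sum (nodePotential E lv)) ⟩
    potential E lv + K * (ℕ→ℚ 2 * Λ)                                   ∎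
    where
    S = total (slack lv) E
    expand : ∀ a b c → a * (b + c) ≡ a * c + a * b
    expand = solve-∀ ring
    swap : ∀ a b c → a + b + c ≡ a + c + b
    swap = solve-∀ ring
    charge : K * (1ℚ + ϵ) * slack lv e ≤ K * (ℕ→ℚ 2 * Λ)
    charge = begin
      K * (1ℚ + ϵ) * slack lv e    ≤⟨ *-mono-≤ˡ K[1+ϵ]-nonNeg (ℕ→ℚ-mono-≤ (ℕₚ.m∸n≤m L (edgeLevel lv e))) ⟩
      K * (1ℚ + ϵ) * Λ             ≤⟨ *-mono-≤ʳ 0≤Λ (*-mono-≤ˡ 0≤K (+-monoʳ-≤ 1ℚ (<⇒≤ ϵ<1))) ⟩
      K * ℕ→ℚ 2 * Λ                ≡⟨ *-assoc K (ℕ→ℚ 2) Λ ⟩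
      K * (ℕ→ℚ 2 * Λ)              ∎
    grow : ∀ u → W E lv u ≤ W (e ∷ E) lv u
    grow = sumAt≤sumAt-∷ (weight-nonNeg lv) e E
    nodes : ∀ u → nodePotential (e ∷ E) lv u ≤ nodePotential E lv u
    nodes u = *-mono-≤ˡ (geo-nonNeg (lv u)) (deficit-antimono (target u) (grow u))

  -- The edge terms only shrink. An endpoint at level l loses at most μβ^-l of weight, which costs
  -- at most μl after scaling by `geo l`. Over at most `f` endpoints, all at levels up to `L`, this
  -- adds up to at most `K * Λ`.
  potential-delete : ∀ E lv e → e ∈ E → ∣ e ∣ ℕ.≤ f → (∀ v → lv v ℕ.≤ L) →
    potential (remove e E) lv ≤ potential E lv + K * (ℕ→ℚ 2 * Λ)
  potential-delete E lv e e∈E ∣e∣≤f lv≤L = begin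
    K * (1ℚ + ϵ) * S' + sum (nodePotential (remove e E) lv)      ≤⟨ +-mono-≤ (*-mono-≤ˡ K[1+ϵ]-nonNeg S'≤S) nodes ⟩
    -- The charge is padded by another `K * Λ` to equal that of an insertion, so that both kinds of
    -- update have one price.
    K * (1ℚ + ϵ) * S + (p + F * (μ * Λ))                         ≤⟨ p≤p+q (*-nonNeg 0≤K 0≤Λ) ⟩
    K * (1ℚ + ϵ) * S + (p + F * (μ * Λ)) + K * Λ                 ≡⟨ collect (K * (1ℚ + ϵ) * S) p F μ Λ ⟩
    K * (1ℚ + ϵ) * S + p + K * (ℕ→ℚ 2 * Λ)                       ∎
    where
    S = total (slack lv) E
    S' = total (slack lv) (remove e E)
    p = sum (nodePotential E lv)
    collect : ∀ s p F μ Λ → s + (p + F * (μ * Λ)) + F * μ * Λ ≡ s + p + F * μ * (ℕ→ℚ 2 * Λ)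
    collect = solve-∀ ring
    S'≤S : S' ≤ S
    S'≤S = ≤-trans (q≤p+q (slack-nonNeg lv e)) (≤-reflexive (sym (total-remove (slack lv) e∈E)))
    node : ∀ u → lookup e u ≡ true → geo (lv u) * weight lv e ≤ μ * Λ
    node u u∈e = begin
      geo (lv u) * weight lv e                    ≤⟨ *-mono-≤ˡ (geo-nonNeg (lv u)) (weight≤ lv e (level≤edgeLevel lv e u∈e)) ⟩
      geo (lv u) * (μ * pow (inv β) (lv u))       ≡⟨ pull (geo (lv u)) μ (pow (inv β) (lv u)) ⟩
      μ * (geo (lv u) * pow (inv β) (lv u))       ≤⟨ *-mono-≤ˡ 0≤μ (≤-trans (geo*powb≤l (lv u)) (ℕ→ℚ-mono-≤ (lv≤L u))) ⟩
      μ * Λ                                       ∎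
      where
      pull : ∀ x y z → x * (y * z) ≡ y * (x * z)
      pull = solve-∀ ring
    drop : ∀ u → geo (lv u) * W E lv u ≤ geo (lv u) * W (remove e E) lv u + gated e (μ * Λ) u
    drop u = begin
      geo (lv u) * W E lv u
        ≡⟨ cong (geo (lv u) *_) (sumAt-remove (weight lv) u e∈E) ⟩
      geo (lv u) * (gated e (weight lv e) u + W (remove e E) lv u)
        ≡⟨ expand (geo (lv u)) (gated e (weight lv e) u) (W (remove e E) lv u) ⟩
      geo (lv u) * W (remove e E) lv u + geo (lv u) * gated e (weight lv e) u
        ≤⟨ +-monoʳ-≤ (geo (lv u) * W (remove e E) lv u) (gated-scale≤ e u (geo (lv u)) (weight lv e) (node u)) ⟩
      geo (lv u) * W (remove e E) lv u + gated e (μ * Λ) u ∎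
      where
      expand : ∀ a b c → a * (b + c) ≡ a * c + a * b
      expand = solve-∀ ring
    nodes : sum (nodePotential (remove e E) lv) ≤ p + F * (μ * Λ)
    nodes = begin
      sum (nodePotential (remove e E) lv)                          ≤⟨ sum-mono-≤ (λ u → deficit-lipschitz (target u) (geo-nonNeg (lv u)) (gated-nonNeg e (*-nonNeg 0≤μ 0≤Λ) u) (drop u)) ⟩
      sum (λ u → nodePotential E lv u + gated e (μ * Λ) u)         ≡⟨ ∑-distrib-+ (nodePotential E lv) (gated e (μ * Λ)) ⟩
      p + sum (gated e (μ * Λ))                                    ≤⟨ +-monoʳ-≤ p (sum-gated≤ e ∣e∣≤f (*-nonNeg 0≤μ 0≤Λ)) ⟩
      p + F * (μ * Λ)                                              ∎

  -- The invariant and the bound on the counter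

  record Invariant (t : ℕ) (s : Config) : Set where
    field
      short   : length (edges s) ℕ.≤ m
      small   : All (λ e → ∣ e ∣ ℕ.≤ f) (edges s)
      bounded : ∀ v → levels s v ℕ.≤ L
      -- Only updates increase `t`, so a change of level leaves the right side fixed and must be
      -- paid for by the potential.
      budget  : K * ϵ * ℕ→ℚ (count s) + potential (edges s) (levels s) ≤ K * (ℕ→ℚ 2 * Λ) * ℕ→ℚ t

  open Invariant

  initial-invariant : Invariant 0 initial
  initial-invariant = record { short = z≤n ; small = [] ; bounded = λ _ → z≤n ; budget = ≤-reflexive start-budget }
    where
    start-budget : K * ϵ * 0ℚ + (K * (1ℚ + ϵ) * 0ℚ + sum (nodePotential [] (λ _ → 0))) ≡ K * (ℕ→ℚ 2 * Λ) * 0ℚ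
    start-budget = begin-equality
      K * ϵ * 0ℚ + (K * (1ℚ + ϵ) * 0ℚ + sum (nodePotential [] (λ _ → 0)))
        ≡⟨ cong (λ p → K * ϵ * 0ℚ + (K * (1ℚ + ϵ) * 0ℚ + p)) (trans (sum-cong-≗ (λ u → *-zeroˡ (deficit (target u) 0ℚ))) (sum-replicate-zero n)) ⟩
      K * ϵ * 0ℚ + (K * (1ℚ + ϵ) * 0ℚ + 0ℚ)
        ≡⟨ vanish (K * ϵ) (K * (1ℚ + ϵ)) (K * (ℕ→ℚ 2 * Λ)) ⟩
      K * (ℕ→ℚ 2 * Λ) * 0ℚ ∎
      where
      vanish : ∀ a b c → a * 0ℚ + (b * 0ℚ + 0ℚ) ≡ c * 0ℚ
      vanish = solve-∀ ring

  setLevel-bounded : ∀ {lv v k} → (∀ u → lv u ℕ.≤ L) → k ℕ.≤ L → ∀ u → setLevel lv v k u ℕ.≤ L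
  setLevel-bounded {lv} {v} {k} lv≤L k≤L u with u Fin.≟ v
  ... | yes _ = k≤L
  ... | no _ = lv≤L u

  pay : ∀ k d {Φ Φ' B} → K * ϵ * ℕ→ℚ d + Φ' ≤ Φ → K * ϵ * ℕ→ℚ k + Φ ≤ B → K * ϵ * ℕ→ℚ (k ℕ.+ d) + Φ' ≤ B
  pay k d {Φ} {Φ'} {B} step paid = begin
    K * ϵ * ℕ→ℚ (k ℕ.+ d) + Φ'                   ≡⟨ cong (λ x → K * ϵ * x + Φ') (ℕ→ℚ-+ k d) ⟩
    K * ϵ * (ℕ→ℚ k + ℕ→ℚ d) + Φ'                 ≡⟨ expand (K * ϵ) (ℕ→ℚ k) (ℕ→ℚ d) Φ' ⟩
    K * ϵ * ℕ→ℚ k + (K * ϵ * ℕ→ℚ d + Φ')         ≤⟨ +-monoʳ-≤ (K * ϵ * ℕ→ℚ k) step ⟩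
    K * ϵ * ℕ→ℚ k + Φ                            ≤⟨ paid ⟩
    B                                            ∎
    where
    expand : ∀ a x y p → a * (x + y) + p ≡ a * x + (a * y + p)
    expand = solve-∀ ring

  fixStep-invariant : ∀ {t s s'} → FixStep s s' → Invariant t s → Invariant t s'
  fixStep-invariant (up E lv k v _ heavy) inv-s = record
    { short = short inv-s
    ; small = small inv-s
    ; bounded = setLevel-bounded (bounded inv-s) lv<L
    ; budget = pay k (changed lv lv' E) (potential-up raise E lv<L (small inv-s) heavy) (budget inv-s)
    }
    where
    lv' = setLevel lv v (suc (lv v))
    raise : Raise lv v lv'
    raise = setLevel-same lv v (suc (lv v)) , setLevel-other lv v (suc (lv v))
    lv<L : lv v ℕ.< L
    -- At level `L` or above the weight would be at most `c v`, which equals `fαβ * c* v`, so the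
    -- node would not be overweight.
    lv<L = ℕₚ.≰⇒> λ L≤lv → <-irrefl refl (<-≤-trans heavy
      (≤-trans (W≤c-at-top E lv (short inv-s) L≤lv) (≤-reflexive (sym (fαβ*c*≡c v)))))
  fixStep-invariant (down E lv k v l _ _ light lv≡1+l) inv-s = record
    { short = short inv-s
    ; small = small inv-s
    ; bounded = setLevel-bounded (bounded inv-s) (ℕₚ.<⇒≤ l<L)
    ; budget = pay k (changed lv lv' E) step (budget inv-s)
    }
    where
    lv' = setLevel lv v l
    -- The lowering from `lv` to `lv'` is read as the raise from `lv'` to `lv`.
    raise : Raise lv' v lv
    raise = trans lv≡1+l (cong suc (sym (setLevel-same lv v l))) , λ u u≢v → sym (setLevel-other lv v l u u≢v)
    l<L : l ℕ.< L
    l<L = subst (ℕ._≤ L) lv≡1+l (bounded inv-s v)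
    step : K * ϵ * ℕ→ℚ (changed lv lv' E) + potential E lv' ≤ potential E lv
    step = subst (λ d → K * ϵ * ℕ→ℚ d + potential E lv' ≤ potential E lv) (changed-sym lv' lv E)
      (potential-down raise E (subst (ℕ._< L) (sym (setLevel-same lv v l)) l<L) light)

  fixSteps-invariant : ∀ {t s s'} → Star FixStep s s' → Invariant t s → Invariant t s'
  fixSteps-invariant ε inv-s = inv-s
  fixSteps-invariant (step ◅ steps) inv-s = fixSteps-invariant steps (fixStep-invariant step inv-s)

  refund : ∀ t x Φ {Φ'} → Φ' ≤ Φ + K * (ℕ→ℚ 2 * Λ) → x + Φ ≤ K * (ℕ→ℚ 2 * Λ) * ℕ→ℚ t →
           x + Φ' ≤ K * (ℕ→ℚ 2 * Λ) * ℕ→ℚ (suc t)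
  refund t x Φ {Φ'} Φ'≤ paid = begin
    x + Φ'                          ≤⟨ +-monoʳ-≤ x Φ'≤ ⟩
    x + (Φ + B)                     ≡⟨ +-assoc x Φ B ⟨
    x + Φ + B                       ≤⟨ +-monoˡ-≤ B paid ⟩
    B * ℕ→ℚ t + B                   ≡⟨ factor B (ℕ→ℚ t) ⟩
    B * (1ℚ + ℕ→ℚ t)                ≡⟨ cong (B *_) (ℕ→ℚ-+ 1 t) ⟨
    B * ℕ→ℚ (suc t)                 ∎
    where
    B = K * (ℕ→ℚ 2 * Λ)
    factor : ∀ b t → b * t + b ≡ b * (1ℚ + t)
    factor = solve-∀ ring

  update-invariant : ∀ {t s s'} → Update s s' → Invariant t s → Invariant (suc t) s'
  update-invariant {t} (insert E lv k e _ _ ∣e∣≤f short') inv-s = record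
    { short = short'
    ; small = ∣e∣≤f ∷ small inv-s
    ; bounded = bounded inv-s
    ; budget = refund t (K * ϵ * ℕ→ℚ k) (potential E lv) (potential-insert E lv e) (budget inv-s)
    }
  update-invariant {t} (delete E lv k e e∈E) inv-s = record
    { short = ℕₚ.≤-trans (length-remove≤ e E) (short inv-s)
    ; small = All-remove e (small inv-s)
    ; bounded = bounded inv-s
    ; budget = refund t (K * ϵ * ℕ→ℚ k) (potential E lv) (potential-delete E lv e e∈E (All.lookup (small inv-s) e∈E) (bounded inv-s)) (budget inv-s)
    }

  handled-invariant : ∀ {t s} → Handled t s → Invariant t s
  handled-invariant start = initial-invariant
  handled-invariant (next handled update steps _) =
    fixSteps-invariant steps (update-invariant update (handled-invariant handled))

  potential-nonNeg : ∀ E lv → 0ℚ ≤ potential E lv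
  potential-nonNeg E lv = +-nonNeg (*-nonNeg K[1+ϵ]-nonNeg (total-nonNeg (slack-nonNeg lv) E))
    (subst (_≤ sum (nodePotential E lv)) (sum-replicate-zero n)
      (sum-mono-≤ λ u → *-nonNeg (geo-nonNeg (lv u)) (0≤deficit (target u) (W E lv u))))

  count≤ : ∀ {t s} → Handled t s → ℕ→ℚ (count s) ≤ ℕ→ℚ (2 ℕ.* t ℕ.* L) * inv ϵ
  count≤ {t} {s} handled = begin
    x                                   ≡⟨ *-identityʳ x ⟨
    x * 1ℚ                              ≡⟨ cong (x *_) (inv-inverseʳ 0<ϵ) ⟨
    x * (ϵ * inv ϵ)                     ≡⟨ *-assoc x ϵ (inv ϵ) ⟨
    x * ϵ * inv ϵ                       ≤⟨ *-mono-≤ʳ (inv-nonNeg 0<ϵ) (*-cancelˡ-≤-pos K {{positive 0<K}} scaled) ⟩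
    ℕ→ℚ 2 * ℕ→ℚ t * Λ * inv ϵ           ≡⟨ cong (λ y → y * Λ * inv ϵ) (ℕ→ℚ-* 2 t) ⟨
    ℕ→ℚ (2 ℕ.* t) * Λ * inv ϵ           ≡⟨ cong (_* inv ϵ) (ℕ→ℚ-* (2 ℕ.* t) L) ⟨
    ℕ→ℚ (2 ℕ.* t ℕ.* L) * inv ϵ         ∎
    where
    x = ℕ→ℚ (count s)
    commute : ∀ K ϵ x → K * (x * ϵ) ≡ K * ϵ * x
    commute = solve-∀ ring
    regroup : ∀ K Λ t → K * (ℕ→ℚ 2 * Λ) * t ≡ K * (ℕ→ℚ 2 * t * Λ)
    regroup = solve-∀ ring
    scaled : K * (x * ϵ) ≤ K * (ℕ→ℚ 2 * ℕ→ℚ t * Λ)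
    scaled = begin
      K * (x * ϵ)                                        ≡⟨ commute K ϵ x ⟩
      K * ϵ * x                                          ≤⟨ p≤p+q (potential-nonNeg (edges s) (levels s)) ⟩
      K * ϵ * x + potential (edges s) (levels s)         ≤⟨ budget (handled-invariant handled) ⟩
      K * (ℕ→ℚ 2 * Λ) * ℕ→ℚ t                            ≡⟨ regroup K Λ (ℕ→ℚ t) ⟩
      K * (ℕ→ℚ 2 * ℕ→ℚ t * Λ)                            ∎

theorem5 : Σ ℕ λ C →
    ∀ (n f m : ℕ) (μ ε : ℚ) (c : Fin n → ℚ) (cmin : ℚ) (L : ℕ) →
    0ℚ < ε → ε < 1ℚ → 1ℚ ≤ μ → 1 Data.Nat.≤ f →
    (∀ v → 0ℚ < c v) →
    (∀ v → cmin ≤ c v) → (∃ λ v → c v ≡ cmin) →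
    IsCeilLog (Dyn.β n f m μ ε c) (ℕ→ℚ m * μ * Dyn.α n f m μ ε c * inv cmin) L →
    ∀ (t : ℕ) (s : Dyn.Config n f m μ ε c) → Dyn.Handled n f m μ ε c t s →
    ℕ→ℚ (Dyn.Config.count s) ≤ ℕ→ℚ (C Data.Nat.* t Data.Nat.* L) * inv ε
-- The constant is the price of one update in units of `K * Λ`; the scale fμ cancels, so it depends
-- on no parameter. Positivity of `cmin` comes from its being attained at some node.
theorem5 = 2 , λ { n f m μ ϵ c cmin L 0<ϵ ϵ<1 1≤μ 1≤f 0<c cmin≤c (v , cv≡cmin) (mμα/cmin≤β^L , _) t s handled →
  Amortised.count≤ n f m μ ϵ c cmin L 0<ϵ ϵ<1 1≤μ 1≤f cmin≤c
    (subst (0ℚ <_) cv≡cmin (0<c v)) mμα/cmin≤β^L handled }
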